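{- Let $L$ be a pairwise similar lobster (with spine $(v_1,\ldots,v_r)$) in which every spinal vertex is essentially odd. Then $L$ is graceful.
   Context: A graph $G=(V,E)$ with $m$ edges is graceful if there is an injective $f:V\to\{0,\ldots,m\}$ with the edge labels $|f(u)-f(v)|$, $uv\in E$, pairwise distinct. A lobster is a tree whose base (the tree obtained by deleting all degree-one vertices) is a caterpillar, a caterpillar being a tree whose base is a path. A lobster $L$ is described by a spine, a path $(v_1,\ldots,v_r)$ of spinal vertices, together with, for each $i$, a tree $F_i$ (the lobe at $v_i$), the lobes being pairwise vertex-disjoint and each meeting the spine only in $v_i$, with $L$ the union of the spine and the lobes; each lobe $F_i$ consists of $v_i$, vertices $u_{i1},\ldots,u_{is_i}$ ($s_i\ge0$) adjacent to $v_i$, and for each $j$ some $k_{ij}\ge 0$ further vertices adjacent only to $u_{ij}$. The star formed by $u_{ij}$ and its $k_{ij}$ other neighbours is a branch at $v_i$; if $k_{ij}=0$, $u_{ij}$ is a pendant vertex at $v_i$. The reduced lobe $F'_i$ is $F_i$ with all pendant vertices at $v_i$ deleted. $L$ is pairwise similar if $F'_i\cong F'_{i+1}$ for all odd $i\in\{1,\ldots,r-1\}$. A spinal vertex $v_i$ is essentially odd if its degree in $F'_i$ is odd, and essentially even if its degree in $F'_i$ is even and non-zero. -}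

module Defs where

open import Data.Bool using (Bool; true; false)
open import Data.Fin using (Fin; toℕ; _≟_; _<?_)
open import Data.Fin.Subset using (Subset; _∈_; _∩_; _─_; ∣_∣)
open import Data.List using (List; length; filter; allFin; cartesianProduct)
open import Data.Nat using (ℕ; suc; _≥_; _%_; _≡ᵇ_; ∣_-_∣)
open import Data.Product using (Σ-syntax; _×_; _,_; proj₁; proj₂)
open import Data.Sum using (_⊎_)
open import Data.Vec using (tabulate)
open import Function.Base using (_∘_)
open import Function.Bundles using (_↔_; _⇔_; module Inverse)
open import Function.Definitions using (Injective)
open import Relation.Binary.Definitions using (Symmetric; Irreflexive; Decidable)
open import Relation.Binary.PropositionalEquality using (_≡_; refl)
open import Relation.Nullary.Decidable using (does; _×-dec_)

record Graph (V : Set) : Set₁ where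
  field
    Adj    : V → V → Set
    sym    : Symmetric Adj
    irrefl : Irreflexive _≡_ Adj
    adj?   : Decidable Adj

open Graph public using (Adj; adj?)

infix 4 _≅_

_≅_ : {V W : Set} → Graph V → Graph W → Set
_≅_ {V} {W} G H =
  Σ[ φ ∈ (V ↔ W) ]
    (∀ x y → Adj G x y ⇔ Adj H (Inverse.to φ x) (Inverse.to φ y))

module _ {n : ℕ} (G : Graph (Fin n)) where

  -- Each edge is counted once, as the pair (x , y) with x < y.
  edges : List (Fin n × Fin n)
  edges = filter (λ (x , y) → (x <? y) ×-dec adj? G x y)
                 (cartesianProduct (allFin n) (allFin n))

  edgeCount : ℕ
  edgeCount = length edges

  Graceful : Set
  Graceful =
    Σ[ f ∈ (Fin n → Fin (suc edgeCount)) ]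
      Injective _≡_ _≡_ f ×
      (∀ u v x y → Adj G u v → Adj G x y →
         ∣ toℕ (f u) - toℕ (f v) ∣ ≡ ∣ toℕ (f x) - toℕ (f y) ∣ →
         (u ≡ x × v ≡ y) ⊎ (u ≡ y × v ≡ x))

  induced : (S : Subset n) → Graph (Σ[ x ∈ Fin n ] x ∈ S)
  induced S = record
    { Adj    = λ x y → Adj G (proj₁ x) (proj₁ y)
    ; sym    = Graph.sym G
    ; irrefl = λ { refl → Graph.irrefl G refl }
    ; adj?   = λ x y → adj? G (proj₁ x) (proj₁ y)
    }

  neighbours : Fin n → Subset n
  neighbours v = tabulate (does ∘ adj? G v)

  -- For v ∈ S, the degree of v in the subgraph induced by S.
  degreeIn : Subset n → Fin n → ℕ
  degreeIn S v = ∣ S ∩ neighbours v ∣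

Odd : ℕ → Set
Odd n = n % 2 ≡ 1

module _ (r : ℕ) (s : Fin r → ℕ) (k : (i : Fin r) → Fin (s i) → ℕ) where

  -- The vertices v_i, u_ij, and the k_ij further neighbours of u_ij.
  -- All indices are 0-based.
  data Position : Set where
    spinal : Fin r → Position
    middle : (i : Fin r) → Fin (s i) → Position
    outer  : (i : Fin r) (j : Fin (s i)) → Fin (k i j) → Position

  data Link : Position → Position → Set where
    along    : ∀ i i′ → toℕ i′ ≡ suc (toℕ i) → Link (spinal i) (spinal i′)
    toMiddle : ∀ i j → Link (spinal i) (middle i j)
    toOuter  : ∀ i j l → Link (middle i j) (outer i j l)

-- A spine of G together with its lobes.  Bijectivity of `position` says that
-- the lobes are pairwise disjoint, meet the spine only in their own v_i, and
-- with the spine cover G; `adjacent` says that G has no edges besides those of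
-- the spine and the lobes.
record Lobster {n : ℕ} (G : Graph (Fin n)) : Set where
  field
    r        : ℕ
    r≥1      : r ≥ 1
    s        : Fin r → ℕ
    k        : (i : Fin r) → Fin (s i) → ℕ
    position : Fin n ↔ Position r s k
    adjacent : ∀ x y → Adj G x y ⇔
                 (Link r s k (Inverse.to position x) (Inverse.to position y) ⊎
                  Link r s k (Inverse.to position y) (Inverse.to position x))

  v : Fin r → Fin n
  v i = Inverse.from position (spinal i)

  lobeOf : Position r s k → Fin r
  lobeOf (spinal i)    = i
  lobeOf (middle i _)  = i
  lobeOf (outer i _ _) = i

  isPendant : Position r s k → Bool
  isPendant (spinal _)    = false
  isPendant (middle i j)  = k i j ≡ᵇ 0
  isPendant (outer _ _ _) = false

  lobe : Fin r → Subset n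
  lobe i = tabulate (λ x → does (lobeOf (Inverse.to position x) ≟ i))

  pendants : Subset n
  pendants = tabulate (isPendant ∘ Inverse.to position)

  reducedLobe : Fin r → Subset n
  reducedLobe i = lobe i ─ pendants

  EssentiallyOdd : Fin r → Set
  EssentiallyOdd i = Odd (degreeIn G (reducedLobe i) (v i))

  -- The i-th spinal vertex in 1-based numbering is the one at index i - 1.
  PairwiseSimilar : Set
  PairwiseSimilar =
    ∀ i i′ → Odd (suc (toℕ i)) → toℕ i′ ≡ suc (toℕ i) →
      induced G (reducedLobe i) ≅ induced G (reducedLobe i′)

module Submission where

-- Write n for the number of vertices of a reduced lobe T with centre v.  If v has odd degree in T,
-- then T has a graceful labelling f with f(v) = 0: start from the star with centre 0 and leaves
-- 1, …, n - 1, and hand the leaves over along the middle vertices n - 1, 1, n - 2, 2, ….  Moving a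
-- set of leaves from w to w′ preserves the set of edge labels when the set is symmetric under
-- z ↦ w + w′ - z, so it suffices to choose the leaves left behind so that symmetry persists.
--
-- Two copies of T are placed at the ends of an interval of labels: the class of v at a + f and the
-- class of the middle vertices at a + D + f in the first copy, and the other way round in the
-- second.  An edge of T with label d gives the two labels D + d and D - d, and the edge joining the
-- centres gives D.  Pendant vertices at the first centre take the labels above the upper block,
-- those at the second centre the labels just above the lower block, and what remains is an interval
-- in which the construction is repeated; an unpaired last lobe is a single copy of T.

open import Algebra.Bundles using (CommutativeMonoid)
open import Data.Bool using (Bool; true; false)
open import Data.Empty using (⊥)
open import Data.Fin as Fin using (Fin; zero; suc; toℕ; inject₁; fromℕ<)
open import Data.Fin.Properties as Fin using (toℕ-injective; toℕ-inject₁; toℕ-fromℕ<)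
open import Data.Fin.Subset using (Subset; _∩_; _─_; ∣_∣) renaming (_∈_ to _∈ˢ_; _∉_ to _∉ˢ_)
open import Data.Fin.Subset.Properties using (x∈p∩q⁺; x∈p∩q⁻)
open import Data.List using (List; []; _∷_; _++_; [_]; map; length; lookup; concat; concatMap;
  filter; replicate; tabulate; allFin)
open import Data.List.Membership.Propositional using (_∈_)
open import Data.List.Membership.Propositional.Properties
open import Data.List.Membership.Propositional.Properties.WithK using (unique∧set⇒bag)
open import Data.List.Properties using (map-++; map-∘; map-id; map-cong; map-cong-local; map-tabulate;
  length-map; length-++; length-replicate; length-tabulate; concat-map; tabulate-cong; tabulate-lookup;
  ∷-injective; filter-none; filter-++; filter-accept; filter-reject)
open import Data.List.Relation.Binary.BagAndSetEquality using (∼bag⇒↭)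
open import Data.List.Relation.Binary.Permutation.Propositional using (_↭_; prep; swap; ↭-refl; ↭-sym;
  ↭-trans; ↭-prep; ↭-swap; ↭-reflexive; ↭⇒↭ₛ; module PermutationReasoning)
open import Data.List.Relation.Binary.Permutation.Propositional.Properties using (map⁺; ++⁺; ++⁺ˡ; ++⁺ʳ;
  shift; shifts; drop-∷; ∷↭∷ʳ; ++-comm; ++-assoc; ++-isCommutativeMonoid; ↭-map-inv; ↭-length;
  filter-↭; All-resp-↭; ∈-resp-↭)
import Data.List.Relation.Binary.Permutation.Setoid.Properties as ↭ₛ
open import Data.List.Relation.Unary.All as All using (All; []; _∷_)
import Data.List.Relation.Unary.All.Properties as All
open import Data.List.Relation.Unary.AllPairs using ([]; _∷_)
open import Data.List.Relation.Unary.Any using (here; there)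
open import Data.List.Relation.Unary.Unique.Propositional using (Unique)
import Data.List.Relation.Unary.Unique.Propositional.Properties as Unique
open import Data.Nat
open import Data.Nat.DivMod using (m*n%n≡0; [m+n]%n≡m%n)
open import Data.Nat.ListAction using (sum)
open import Data.Nat.ListAction.Properties using (sum-↭; sum-++)
open import Data.Nat.Properties
open import Data.Nat.Tactic.RingSolver using (solve-∀)
open import Data.Product using (Σ-syntax; ∃; ∃₂; _×_; _,_; proj₁; proj₂)
open import Data.Sum using (_⊎_; inj₁; inj₂)
open import Data.Vec as Vec using ([]; _∷_; here; there)
import Data.Vec.Properties as Vec
open import Data.Vec.Properties.WithK using ([]=-irrelevant)
open import Function using (_∘_; id)
open import Function.Bundles using (_⇔_; mk⇔; module Inverse; module Equivalence)
open import Relation.Binary.Definitions using (tri<; tri≈; tri>)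
open import Relation.Binary.PropositionalEquality using (_≡_; _≢_; refl; sym; trans; cong; cong₂;
  subst; subst₂; setoid; module ≡-Reasoning)
open import Relation.Nullary using (Dec; yes; no; does; ¬_; ¬?; contradiction)
open import Relation.Nullary.Decidable using (dec-true)
open import Defs

-- Intervals of labels, up to permutation.

iv : ℕ → ℕ → List ℕ
iv a zero    = []
iv a (suc n) = a ∷ iv (suc a) n

iv-++ : ∀ a m n → iv a (m + n) ≡ iv a m ++ iv (a + m) n
iv-++ a zero    n rewrite +-identityʳ a = refl
iv-++ a (suc m) n rewrite +-suc a m = cong (a ∷_) (iv-++ (suc a) m n)

iv-suc : ∀ a n → iv a (suc n) ↭ (a + n) ∷ iv a n
iv-suc a n = ↭-trans (↭-reflexive (trans (cong (iv a) (sym (+-comm n 1))) (iv-++ a n 1)))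
                     (↭-sym (∷↭∷ʳ (a + n) (iv a n)))

map-+-iv : ∀ c a n → map (c +_) (iv a n) ≡ iv (c + a) n
map-+-iv c a zero    = refl
map-+-iv c a (suc n) = cong (c + a ∷_) (trans (map-+-iv c (suc a) n) (cong (λ z → iv z n) (+-suc c a)))

-- Unless the intervals are empty, the first entry of either and the last entry of the other add up
-- to `c`, so the reflection exchanges them; writing `suc c` avoids a subtraction. With `a` equal to
-- `b` this is the symmetry of an interval about its midpoint.
map-∸-iv : ∀ a b n {c} → a + b + n ≡ suc c → map (c ∸_) (iv a n) ↭ iv b n
map-∸-iv a b zero    eq = ↭-refl
map-∸-iv a b (suc n) {c} eq = ↭-trans (↭-trans (↭-reflexive (cong (_∷ map (c ∸_) (iv (suc a) n)) c∸a≡b+n))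
    (↭-prep (b + n) (map-∸-iv (suc a) b n (trans (sym (+-suc (a + b) n)) eq))))
    (↭-sym (iv-suc b n))
  where
  c∸a≡b+n : c ∸ a ≡ b + n
  c∸a≡b+n = trans (cong (_∸ a) (trans (suc-injective (trans (sym eq) (+-suc (a + b) n))) (+-assoc a b n)))
                  (m+n∸m≡n a (b + n))

length-iv : ∀ a n → length (iv a n) ≡ n
length-iv a zero    = refl
length-iv a (suc n) = cong suc (length-iv (suc a) n)

iv-lower : ∀ a n → All (a ≤_) (iv a n)
iv-lower a zero    = []
iv-lower a (suc n) = ≤-refl ∷ All.map (≤-trans (n≤1+n a)) (iv-lower (suc a) n)

iv-upper : ∀ a n {c} → a + n ≤ suc c → All (_≤ c) (iv a n)
iv-upper a zero    le = []
iv-upper a (suc n) {c} le = s≤s⁻¹ (≤-trans (m≤m+n (suc a) n) le′) ∷ iv-upper (suc a) n le′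
  where le′ = subst (_≤ suc c) (+-suc a n) le

iv-unique : ∀ a n → Unique (iv a n)
iv-unique a zero    = []
iv-unique a (suc n) = All.map <⇒≢ (iv-lower (suc a) n) ∷ iv-unique (suc a) n

concatMap-↭ : ∀ {A B : Set} (f : A → List B) {xs ys} → xs ↭ ys → concatMap f xs ↭ concatMap f ys
concatMap-↭ f _↭_.refl          = ↭-refl
concatMap-↭ f (prep x p)    = ++⁺ˡ (f x) (concatMap-↭ f p)
concatMap-↭ f (swap x y p)  = ↭-trans (shifts (f x) (f y)) (++⁺ˡ (f y) (++⁺ˡ (f x) (concatMap-↭ f p)))
concatMap-↭ f (_↭_.trans p q)   = ↭-trans (concatMap-↭ f p) (concatMap-↭ f q)

-- Feeds the solver used below to regroup concatenations up to permutation.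
↭-commutativeMonoid : Set → CommutativeMonoid _ _
↭-commutativeMonoid A = record { isCommutativeMonoid = ++-isCommutativeMonoid {A = A} }

-- Branches, and leaves handed over along a zigzag of middle vertices.

Branch : Set
Branch = ℕ × List ℕ

size : Branch → ℕ
size = length ∘ proj₂

mids : List Branch → List ℕ
mids = map proj₁

outs : List Branch → List ℕ
outs = concatMap proj₂

dists : Branch → List ℕ
dists (b , os) = map (λ o → ∣ o - b ∣) os

-- A set D of leaves, given by their distances from the current middle vertex w, is handed over:
-- K stays with w, and D′ moves to the vertex w′ at distance suc E from w on the far side of D.  As D′
-- is symmetric under suc E ∸_, it is also the set of distances from w′.  The vertex after w′ is at
-- distance E from w′, since the middle vertices are m, 1, m - 1, 2, ….
data Chain : ℕ → List ℕ → List (List ℕ) → Set where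
  []   : ∀ {E} → Chain E [] []
  step : ∀ {E D D′ K Ks} → D ↭ K ++ D′ → map (suc E ∸_) D′ ↭ D′ → All (_≤ suc E) D′ →
         Chain E D′ Ks → Chain (suc E) D (K ∷ Ks)

-- In `hi` the current middle vertex lies above its leaves, in `lo` below them. `E` is the distance
-- to the next middle vertex; it falls by one each time, so the middle vertices zigzag inwards.
hi lo : ℕ → ℕ → List (List ℕ) → List Branch
hi y E []       = []
hi y E (K ∷ Ks) = (y , map (y ∸_) K) ∷ lo (y ∸ E) (E ∸ 1) Ks
lo x E []       = []
lo x E (K ∷ Ks) = (x , map (x +_) K) ∷ hi (x + E) (E ∸ 1) Ks

sizes-hi : ∀ y E Ks → map size (hi y E Ks) ≡ map length Ks
sizes-lo : ∀ x E Ks → map size (lo x E Ks) ≡ map length Ks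
sizes-hi y E []       = refl
sizes-hi y E (K ∷ Ks) = cong₂ _∷_ (length-map _ K) (sizes-lo _ _ Ks)
sizes-lo x E []       = refl
sizes-lo x E (K ∷ Ks) = cong₂ _∷_ (length-map _ K) (sizes-hi _ _ Ks)

-- Change of reference point: what lies `d` below the upper middle vertex `x + c` lies `c ∸ d` above
-- the lower one `x`.
reflect : ∀ x {c D} → All (_≤ c) D → map (x +_) (map (c ∸_) D) ≡ map ((x + c) ∸_) D
reflect x {c} D≤c = trans (sym (map-∘ _)) (map-cong-local (All.map (λ d≤c → sym (+-∸-assoc x d≤c)) D≤c))

-- Handing over `D′` does not change the labels it occupies: measuring from the next middle vertex
-- replaces each distance by its reflection, and `D′` is closed under that reflection. The bound
-- `E ≤ y` keeps the step down to the next middle vertex from being truncated.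
outs-hi : ∀ {y E D Ks} → E ≤ y → Chain E D Ks → outs (hi y E Ks) ↭ map (y ∸_) D
outs-lo : ∀ {x E D Ks} → Chain E D Ks → outs (lo x E Ks) ↭ map (x +_) D
outs-hi E≤y [] = ↭-refl
outs-hi {y} {suc E} E<y (step {D′ = D′} {K} {Ks} D↭ sym↭ D′≤ ch) = begin
  map (y ∸_) K ++ outs (lo (y ∸ suc E) E Ks)       ↭⟨ ++⁺ˡ _ (outs-lo ch) ⟩
  map (y ∸_) K ++ map (y ∸ suc E +_) D′            ↭⟨ ++⁺ˡ _ (map⁺ _ sym↭) ⟨
  map (y ∸_) K ++ map (y ∸ suc E +_) (map (suc E ∸_) D′) ≡⟨ cong (map (y ∸_) K ++_) (trans (reflect _ D′≤)
        (cong (λ z → map (z ∸_) D′) (m∸n+n≡m E<y))) ⟩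
  map (y ∸_) K ++ map (y ∸_) D′                    ≡⟨ map-++ _ K D′ ⟨
  map (y ∸_) (K ++ D′)                             ↭⟨ map⁺ _ D↭ ⟨
  map (y ∸_) _                                     ∎
  where open PermutationReasoning
outs-lo [] = ↭-refl
outs-lo {x} {suc E} (step {D′ = D′} {K} {Ks} D↭ sym↭ D′≤ ch) = begin
  map (x +_) K ++ outs (hi (x + suc E) E Ks)       ↭⟨ ++⁺ˡ _ (outs-hi (≤-trans (n≤1+n E) (m≤n+m (suc E) x)) ch) ⟩
  map (x +_) K ++ map ((x + suc E) ∸_) D′          ≡⟨ cong (map (x +_) K ++_) (reflect x D′≤) ⟨
  map (x +_) K ++ map (x +_) (map (suc E ∸_) D′)   ↭⟨ ++⁺ˡ _ (map⁺ _ sym↭) ⟩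
  map (x +_) K ++ map (x +_) D′                    ≡⟨ map-++ _ K D′ ⟨
  map (x +_) (K ++ D′)                             ↭⟨ map⁺ _ D↭ ⟨
  map (x +_) _                                     ∎
  where open PermutationReasoning

map-id-local : ∀ {f : ℕ → ℕ} {xs} → All (λ x → f x ≡ x) xs → map f xs ≡ xs
map-id-local []       = refl
map-id-local (p ∷ ps) = cong₂ _∷_ p (map-id-local ps)

dists-hi-K : ∀ {y K} → All (_≤ y) K → dists (y , map (y ∸_) K) ≡ K
dists-hi-K {y} {K} K≤y = trans (sym (map-∘ K)) (map-id-local (All.map
  (λ {d} d≤y → trans (m≤n⇒∣m-n∣≡n∸m (m∸n≤m y d)) (m∸[m∸n]≡n d≤y)) K≤y))

dists-lo-K : ∀ {x} K → dists (x , map (x +_) K) ≡ K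
dists-lo-K {x} K = trans (sym (map-∘ K)) (map-id-local (All.universal (λ d → trans (∣-∣-comm (x + d) x) (∣m-m+n∣≡n x d)) K))

-- By symmetry the leaves handed over have the same set of distances from the new middle vertex, so
-- together with the distances `K` kept at the old one the edge labels are again `D`. The bound on
-- `D` lets `y ∸_` be undone.
dists-hi : ∀ {y E D Ks} → E ≤ y → All (_≤ y) D → Chain E D Ks → concatMap dists (hi y E Ks) ↭ D
dists-lo : ∀ {x E D Ks} → Chain E D Ks → concatMap dists (lo x E Ks) ↭ D
dists-hi E≤y _ [] = ↭-refl
dists-hi {y} E<y D≤y (step {K = K} D↭ sym↭ D′≤ ch) = ↭-trans
  (++⁺ (↭-reflexive (dists-hi-K (All.++⁻ˡ K (All-resp-↭ D↭ D≤y)))) (dists-lo ch))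
  (↭-sym D↭)
dists-lo [] = ↭-refl
dists-lo {x} {suc E} (step {K = K} D↭ sym↭ D′≤ ch) = ↭-trans
  (++⁺ (↭-reflexive (dists-lo-K K))
       (dists-hi (≤-trans (n≤1+n E) (m≤n+m (suc E) x)) (All.map (λ le → ≤-trans le (m≤n+m (suc E) x)) D′≤) ch))
  (↭-sym D↭)

-- The zigzag climbs from `x` by ones and, in alternation, descends from `x + (h + h + e)`, which
-- for positive `h` is the last entry of `iv b h`. In the form `h + h + e` the distance is large
-- enough for its predecessors not to be truncated while vertices remain.
mids-lo : ∀ h {x b e Ks} → length Ks ≡ h + h → b + h ≡ suc (x + (h + h + e)) →
          mids (lo x (h + h + e) Ks) ↭ iv x h ++ iv b h
mids-lo zero {Ks = []} len eq = ↭-refl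
mids-lo (suc h) {Ks = []} ()
mids-lo (suc h) {Ks = _ ∷ []} len eq with trans len (cong suc (+-suc h h))
... | ()
mids-lo (suc h) {x} {b} {e} {_ ∷ _ ∷ Ks} len eq rewrite +-suc h h = ↭-prep x (begin
  x + suc (suc E) ∷ mids (lo (x + suc (suc E) ∸ suc E) E Ks) ≡⟨ cong₂ (λ u w → u ∷ mids (lo w E Ks)) y≡ x′≡ ⟩
  b + h ∷ mids (lo (suc x) E Ks)    ↭⟨ ↭-prep _ (mids-lo h (suc-injective (suc-injective len)) eq′) ⟩
  b + h ∷ iv (suc x) h ++ iv b h    ↭⟨ shift (b + h) (iv (suc x) h) (iv b h) ⟨
  iv (suc x) h ++ b + h ∷ iv b h    ↭⟨ ++⁺ˡ (iv (suc x) h) (iv-suc b h) ⟨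
  iv (suc x) h ++ iv b (suc h)      ∎)
  where
  open PermutationReasoning
  E = h + h + e
  eq₀ : b + h ≡ x + suc (suc E)
  eq₀ = suc-injective (trans (sym (+-suc b h)) eq)
  y≡ = sym eq₀
  eq′ : b + h ≡ suc (suc x + E)
  eq′ = trans eq₀ (trans (+-suc x (suc E)) (cong suc (+-suc x E)))
  x′≡ : x + suc (suc E) ∸ suc E ≡ suc x
  x′≡ = trans (cong (_∸ suc E) (+-suc x (suc E))) (m+n∸n≡m (suc x) (suc E))

-- Choosing the leaves that stay, and the labelling of a reduced lobe.

oddSize evenSize : ℕ → ℕ
oddSize j = suc (j + j)
evenSize j = suc (suc (j + j))

module _ where
  open import Algebra.Solver.CommutativeMonoid (↭-commutativeMonoid ℕ) using (solve; _⊜_; _⊕_) renaming (id to ε)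

  -- The leaves form two intervals of equal length.  A branch of even size takes the topmost leaf and
  -- an odd number of leaves next to the gap between the intervals.
  evenChain : ∀ es p c {E} → p + c + sum (map suc es) ≡ E → let n = sum (map suc es) in
    ∃ λ Ks → Chain E (iv (suc p) n ++ iv (suc c) n) Ks × map length Ks ≡ map evenSize es
  evenChain []       p c eq = [] , [] , refl
  evenChain (j ∷ es) p c {E} eq = K ∷ Ks , subst (λ E → Chain E _ (K ∷ Ks)) E≡ (step D↭ sym↭ D′≤ ch) , cong₂ _∷_ len lens
    where
    open PermutationReasoning
    n = sum (map suc es)
    K = iv (suc p + n) (suc j) ++ iv (suc c) j ++ iv (suc c + j + n) 1
    -- The upper interval starts `j` later and both have lost `suc j` entries, so the sum of the two
    -- outer ends falls by one, as does the distance between successive middle vertices.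
    IH = evenChain es p (c + j) refl
    Ks = proj₁ IH
    ch = proj₁ (proj₂ IH)
    lens = proj₂ (proj₂ IH)
    E≡ : suc (p + (c + j) + n) ≡ E
    E≡ = trans (lemma p c j n) eq where
      lemma : ∀ p c j n → suc (p + (c + j) + n) ≡ p + c + (suc j + n)
      lemma = solve-∀
    D↭ : iv (suc p) (suc j + n) ++ iv (suc c) (suc j + n) ↭ K ++ iv (suc p) n ++ iv (suc (c + j)) n
    D↭ = begin
      iv (suc p) (suc j + n) ++ iv (suc c) (suc j + n)
        ≡⟨ cong₂ _++_ (trans (cong (iv (suc p)) (+-comm (suc j) n)) (iv-++ (suc p) n (suc j)))
            (trans (cong (iv (suc c)) (lemma j n))
              (trans (iv-++ (suc c) j (n + 1)) (cong (iv (suc c) j ++_) (iv-++ (suc c + j) n 1)))) ⟩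
      (iv (suc p) n ++ iv (suc p + n) (suc j)) ++ (iv (suc c) j ++ (iv (suc c + j) n ++ iv (suc c + j + n) 1))
        ↭⟨ solve 5 (λ a b c d e → (a ⊕ b) ⊕ (c ⊕ (d ⊕ e)) ⊜ (b ⊕ (c ⊕ e)) ⊕ (a ⊕ d)) ↭-refl
             (iv (suc p) n) (iv (suc p + n) (suc j)) (iv (suc c) j) (iv (suc c + j) n) (iv (suc c + j + n) 1) ⟩
      K ++ iv (suc p) n ++ iv (suc (c + j)) n ∎
      where
      lemma : ∀ j n → suc j + n ≡ j + (n + 1)
      lemma = solve-∀
    E′ = p + (c + j) + n
    -- Each of the two intervals is reflected onto the other.
    sym↭ : map (suc E′ ∸_) (iv (suc p) n ++ iv (suc (c + j)) n) ↭ iv (suc p) n ++ iv (suc (c + j)) n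
    sym↭ = begin
      map (suc E′ ∸_) (iv (suc p) n ++ iv (suc (c + j)) n) ≡⟨ map-++ _ (iv (suc p) n) _ ⟩
      map (suc E′ ∸_) (iv (suc p) n) ++ map (suc E′ ∸_) (iv (suc (c + j)) n)
        ↭⟨ ++⁺ (map-∸-iv (suc p) (suc (c + j)) n (l1 p c j n)) (map-∸-iv (suc (c + j)) (suc p) n (l2 p c j n)) ⟩
      iv (suc (c + j)) n ++ iv (suc p) n ↭⟨ ++-comm (iv (suc (c + j)) n) _ ⟩
      iv (suc p) n ++ iv (suc (c + j)) n ∎
      where
      l1 : ∀ p c j n → suc p + suc (c + j) + n ≡ suc (suc (p + (c + j) + n))
      l1 = solve-∀
      l2 : ∀ p c j n → suc (c + j) + suc p + n ≡ suc (suc (p + (c + j) + n))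
      l2 = solve-∀
    D′≤ : All (_≤ suc E′) (iv (suc p) n ++ iv (suc (c + j)) n)
    D′≤ = All.++⁺
      (iv-upper (suc p) n (s≤s (m≤n⇒m≤1+n
        (≤-trans (m≤m+n (p + n) (c + j)) (≤-reflexive (l1 p (c + j) n))))))
      (iv-upper (suc (c + j)) n (s≤s (m≤n⇒m≤1+n
        (≤-trans (m≤n+m (c + j + n) p) (≤-reflexive (sym (+-assoc p (c + j) n)))))))
      where
      l1 : ∀ p c n → p + n + c ≡ p + c + n
      l1 = solve-∀
    len : length K ≡ evenSize j
    len = trans (length-++ (iv (suc p + n) (suc j))) (trans (cong₂ _+_ (length-iv _ (suc j))
            (trans (length-++ (iv (suc c) j)) (cong (_+ 1) (length-iv _ j)))) (l j))
      where
      l : ∀ j → suc j + (j + 1) ≡ suc (suc (j + j))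
      l = solve-∀

  -- A branch of odd size takes leaves from the two ends of a single interval.  Once only even sizes
  -- remain, the interval has even length and is cut into two halves.
  oddChain : ∀ os es p {E} → let n = sum (map oddSize os) + sum (map evenSize es) in p + p + n ≡ E →
    ∃ λ Ks → Chain E (iv (suc p) n) Ks × map length Ks ≡ map oddSize os ++ map evenSize es
  oddChain []       es p {E} eq = Ks , subst (λ D → Chain E D Ks) (sym D≡) ch , lens
    where
    N = sum (map suc es)
    sum-evenSize : ∀ es → sum (map evenSize es) ≡ sum (map suc es) + sum (map suc es)
    sum-evenSize []       = refl
    sum-evenSize (e ∷ es) = trans (cong (evenSize e +_) (sum-evenSize es)) (l e _) where
      l : ∀ e s → suc (suc (e + e)) + (s + s) ≡ suc e + s + (suc e + s)
      l = solve-∀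
    D≡ : iv (suc p) (sum (map evenSize es)) ≡ iv (suc p) N ++ iv (suc (p + N)) N
    D≡ = trans (cong (iv (suc p)) (sum-evenSize es)) (iv-++ (suc p) N N)
    R = evenChain es p (p + N) (trans (l p N) (trans (cong (p + p +_) (sym (sum-evenSize es))) eq)) where
      l : ∀ p n → p + (p + n) + n ≡ p + p + (n + n)
      l = solve-∀
    Ks = proj₁ R
    ch = proj₁ (proj₂ R)
    lens = proj₂ (proj₂ R)
  oddChain (j ∷ os) es p {E} eq = K ∷ Ks
    , subst₂ (λ E n → Chain E (iv (suc p) n) (K ∷ Ks)) E≡ (sym n≡) (step D↭ sym↭ D′≤ ch)
    , cong₂ _∷_ len lens
    where
    open PermutationReasoning
    n = sum (map oddSize os) + sum (map evenSize es)
    n≡ : oddSize j + sum (map oddSize os) + sum (map evenSize es) ≡ oddSize j + n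
    n≡ = +-assoc (oddSize j) _ _
    -- One leaf more is taken at the top than at the bottom, so the sum of the end points falls by
    -- one and what remains is symmetric under `suc E′ ∸_`.
    K = iv (suc p) j ++ iv (suc p + j + n) (suc j)
    IH = oddChain os es (p + j) refl
    Ks = proj₁ IH
    ch = proj₁ (proj₂ IH)
    lens = proj₂ (proj₂ IH)
    E′ = p + j + (p + j) + n
    E≡ : suc E′ ≡ E
    E≡ = trans (l p j n) (trans (cong (p + p +_) (sym n≡)) eq) where
      l : ∀ p j n → suc (p + j + (p + j) + n) ≡ p + p + (suc (j + j) + n)
      l = solve-∀
    D↭ : iv (suc p) (oddSize j + n) ↭ K ++ iv (suc (p + j)) n
    D↭ = begin
      iv (suc p) (oddSize j + n) ≡⟨ cong (iv (suc p)) (l j n) ⟩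
      iv (suc p) (j + (n + suc j)) ≡⟨ trans (iv-++ (suc p) j (n + suc j)) (cong (iv (suc p) j ++_) (iv-++ (suc p + j) n (suc j))) ⟩
      iv (suc p) j ++ (iv (suc p + j) n ++ iv (suc p + j + n) (suc j))
        ↭⟨ solve 3 (λ a b c → a ⊕ (b ⊕ c) ⊜ (a ⊕ c) ⊕ b) ↭-refl (iv (suc p) j) (iv (suc p + j) n) (iv (suc p + j + n) (suc j)) ⟩
      K ++ iv (suc (p + j)) n ∎
      where
      l : ∀ j n → suc (j + j) + n ≡ j + (n + suc j)
      l = solve-∀
    sym↭ : map (suc E′ ∸_) (iv (suc (p + j)) n) ↭ iv (suc (p + j)) n
    sym↭ = map-∸-iv (suc (p + j)) (suc (p + j)) n (l p j n) where
      l : ∀ p j n → suc (p + j) + suc (p + j) + n ≡ suc (suc (p + j + (p + j) + n))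
      l = solve-∀
    D′≤ : All (_≤ suc E′) (iv (suc (p + j)) n)
    D′≤ = iv-upper (suc (p + j)) n (s≤s (m≤n⇒m≤1+n
      (≤-trans (m≤n+m (p + j + n) (p + j)) (≤-reflexive (sym (+-assoc (p + j) (p + j) n))))))
    len : length K ≡ oddSize j
    len = trans (length-++ (iv (suc p) j)) (trans (cong₂ _+_ (length-iv (suc p) j) (length-iv _ (suc j))) (+-suc j j))

halve : ∀ n → (∃ λ j → n ≡ j + j) ⊎ (∃ λ j → n ≡ oddSize j)
halve zero = inj₁ (0 , refl)
halve (suc n) with halve n
... | inj₁ (j , eq) = inj₂ (j , cong suc eq)
... | inj₂ (j , eq) = inj₁ (suc j , cong suc (trans eq (sym (+-suc j j))))

-- The odd sizes come first because `oddChain` treats them on a single interval and only then cuts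
-- it in two for the even sizes.
splitParity : ∀ ks → All (_≢ 0) ks → ∃₂ λ os es → ks ↭ map oddSize os ++ map evenSize es
splitParity []       []         = [] , [] , ↭-refl
splitParity (k ∷ ks) (k≢0 ∷ ps) with splitParity ks ps | halve k
... | os , es , p | inj₂ (j , refl)     = j ∷ os , es , ↭-prep (oddSize j) p
... | os , es , p | inj₁ (zero , refl)  = contradiction refl k≢0
... | os , es , p | inj₁ (suc j , refl) = os , j ∷ es , ↭-trans (↭-prep _ p) (↭-trans
        (↭-reflexive (cong (λ z → suc z ∷ map oddSize os ++ map evenSize es) (+-suc j j)))
        (↭-sym (shift (evenSize j) (map oddSize os) (map evenSize es))))

odd⇒oddSize : ∀ {n} → Odd n → ∃ λ h → n ≡ oddSize h
odd⇒oddSize {n} o with halve n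
... | inj₂ r = r
... | inj₁ (j , refl) with trans (sym o) (even j)
  where
  even : ∀ j → (j + j) % 2 ≡ 0
  even j = trans (cong (_% 2) (l j)) (m*n%n≡0 j 2) where
    l : ∀ j → j + j ≡ j * 2
    l = solve-∀
...   | ()

length≤sum : ∀ {ks} → All (_≢ 0) ks → length ks ≤ sum ks
length≤sum []       = z≤n
length≤sum (p ∷ ps) = +-mono-≤ (n≢0⇒n>0 p) (length≤sum ps)

-- With 2h + 1 middle vertices and S leaves, the middle vertices take the labels 1, ..., h and the
-- topmost h + 1, and the leaves take those in between. An edge at the centre 0 has the label of its
-- middle vertex, and by the chain the edges to the leaves have the labels h + 1, ..., h + S; so the
-- edges use the same labels as the vertices other than the centre.
reducedLobeLabelling : ∀ ks → All (_≢ 0) ks → Odd (length ks) → let e = length ks + sum ks in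
  ∃ λ bs → map size bs ≡ ks × 0 ∷ mids bs ++ outs bs ↭ iv 0 (suc e) × mids bs ++ concatMap dists bs ↭ iv 1 e
reducedLobeLabelling ks nz odd with splitParity ks nz | odd⇒oddSize odd
... | os , es , ks↭ | h , t≡ = bs , sym ks≡ , vertices↭ , edgeLabels
  where
  open PermutationReasoning
  ks′ = map oddSize os ++ map evenSize es
  S = sum (map oddSize os) + sum (map evenSize es)
  S≡ : sum ks ≡ S
  S≡ = trans (sum-↭ ks↭) (sum-++ (map oddSize os) (map evenSize es))
  -- Starting at `h` leaves room for the `h` lowest middle vertices; the distance `E` then leads
  -- from the first middle vertex `m` to the label 1.
  chain = oddChain os es h refl
  Ks = proj₁ chain
  ch = proj₁ (proj₂ chain)
  E = h + h + S
  m = suc E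
  bs₀ = hi m E Ks
  bs₀-sizes : map size bs₀ ≡ ks′
  bs₀-sizes = trans (sizes-hi m E Ks) (proj₂ (proj₂ chain))
  -- The chain lists the odd sizes first; here the branches return to the order of `ks`.
  reorder = ↭-map-inv size (subst (_↭ ks) (sym bs₀-sizes) (↭-sym ks↭))
  bs = proj₁ reorder
  ks≡ = proj₁ (proj₂ reorder)
  bs↭ : bs ↭ bs₀
  bs↭ = ↭-sym (proj₂ (proj₂ reorder))
  len : length Ks ≡ oddSize h
  len = trans (sym (length-map length Ks)) (trans (cong length (proj₂ (proj₂ chain))) (trans (sym (↭-length ks↭)) t≡))
  D = iv (suc h) S
  -- Positivity of `S` puts `E₁ ∸ 1` into the form `h + h + s` that `mids-lo` expects.
  mids↭ : ∀ {S Ks} → 0 < S → length Ks ≡ oddSize h → mids (hi (suc (h + h + S)) (h + h + S) Ks) ↭ iv 1 h ++ iv (suc h + S) (suc h)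
  mids↭ {S = suc s} {_ ∷ Ks} _ len = begin
    m₁ ∷ mids (lo (m₁ ∸ E₁) (E₁ ∸ 1) Ks)        ≡⟨ cong₂ (λ x F → m₁ ∷ mids (lo x F Ks)) (m+n∸n≡m 1 E₁) (cong (_∸ 1) (+-suc (h + h) s)) ⟩
    m₁ ∷ mids (lo 1 (h + h + s) Ks)          ↭⟨ ↭-prep m₁ (mids-lo h (suc-injective len) (l h s)) ⟩
    m₁ ∷ iv 1 h ++ iv (suc h + suc s) h      ↭⟨ shift m₁ (iv 1 h) _ ⟨
    iv 1 h ++ m₁ ∷ iv (suc h + suc s) h      ≡⟨ cong (λ z → iv 1 h ++ z ∷ iv (suc h + suc s) h) (l′ h s) ⟩
    iv 1 h ++ suc h + suc s + h ∷ iv (suc h + suc s) h ↭⟨ ++⁺ˡ (iv 1 h) (iv-suc (suc h + suc s) h) ⟨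
    iv 1 h ++ iv (suc h + suc s) (suc h)    ∎
    where
    E₁ = h + h + suc s
    m₁ = suc E₁
    l : ∀ h s → suc h + suc s + h ≡ suc (1 + (h + h + s))
    l = solve-∀
    l′ : ∀ h s → suc (h + h + suc s) ≡ suc h + suc s + h
    l′ = solve-∀
  outs↭ : outs bs₀ ↭ D
  outs↭ = ↭-trans (outs-hi (n≤1+n E) ch) (map-∸-iv (suc h) (suc h) S (l h S)) where
    l : ∀ h s → suc h + suc h + s ≡ suc (suc (h + h + s))
    l = solve-∀
  dists↭ : concatMap dists bs₀ ↭ D
  dists↭ = dists-hi (n≤1+n E) (iv-upper (suc h) S (s≤s (m≤n⇒m≤1+n (+-monoˡ-≤ S (m≤m+n h h))))) ch
  -- There is a middle vertex, since their number is odd, and each of them has a leaf.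
  0<S : 0 < S
  0<S = subst (0 <_) S≡ (≤-trans (subst (0 <_) (sym t≡) z<s) (length≤sum nz))
  whole : mids bs₀ ++ D ↭ iv 1 (length ks + sum ks)
  whole = begin
    mids bs₀ ++ D ↭⟨ ++⁺ʳ D (mids↭ 0<S len) ⟩
    (iv 1 h ++ iv (suc h + S) (suc h)) ++ D ↭⟨ ++-assoc (iv 1 h) _ D ⟩
    iv 1 h ++ (iv (suc h + S) (suc h) ++ D) ↭⟨ ++⁺ˡ (iv 1 h) (++-comm _ D) ⟩
    iv 1 h ++ (D ++ iv (suc h + S) (suc h)) ≡⟨ cong (iv 1 h ++_) (iv-++ (suc h) S (suc h)) ⟨
    iv 1 h ++ iv (1 + h) (S + suc h)        ≡⟨ iv-++ 1 h (S + suc h) ⟨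
    iv 1 (h + (S + suc h))                  ≡⟨ cong (iv 1) (trans (l h S) (sym (cong₂ _+_ t≡ S≡))) ⟩
    iv 1 (length ks + sum ks)               ∎
    where
    l : ∀ h s → h + (s + suc h) ≡ suc (h + h) + s
    l = solve-∀
  vertices↭ : 0 ∷ mids bs ++ outs bs ↭ iv 0 (suc (length ks + sum ks))
  vertices↭ = ↭-prep 0 (↭-trans (++⁺ (map⁺ proj₁ bs↭) (↭-trans (concatMap-↭ proj₂ bs↭) outs↭)) whole)
  edgeLabels : mids bs ++ concatMap dists bs ↭ iv 1 (length ks + sum ks)
  edgeLabels = ↭-trans (++⁺ (map⁺ proj₁ bs↭) (↭-trans (concatMap-↭ dists bs↭) dists↭)) whole

-- Labelled lobes and their translates.

Lobe : Set
Lobe = ℕ × List Branch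

dist : ℕ × ℕ → ℕ
dist (x , y) = ∣ x - y ∣

branchPairs : Branch → List (ℕ × ℕ)
branchPairs (b , os) = map (_, b) os

lobeVertices : Lobe → List ℕ
lobeVertices (v , bs) = v ∷ mids bs ++ outs bs

-- Each edge is listed with its middle vertex second, so that the two colour classes are separated.
lobePairs : Lobe → List (ℕ × ℕ)
lobePairs (v , bs) = map (v ,_) (mids bs) ++ concatMap branchPairs bs

lobeEdges : Lobe → List ℕ
lobeEdges = map dist ∘ lobePairs

links : List ℕ → List ℕ
links []           = []
links (x ∷ [])     = []
links (x ∷ y ∷ xs) = ∣ x - y ∣ ∷ links (y ∷ xs)

spine : List Lobe → List ℕ
spine = map proj₁

lobePairs-↭ : ∀ v {bs bs′} → bs ↭ bs′ → lobePairs (v , bs) ↭ lobePairs (v , bs′)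
lobePairs-↭ v p = ++⁺ (map⁺ (v ,_) (map⁺ proj₁ p)) (concatMap-↭ branchPairs p)

lobeVertices-↭ : ∀ v {bs bs′} → bs ↭ bs′ → lobeVertices (v , bs) ↭ lobeVertices (v , bs′)
lobeVertices-↭ v p = ↭-prep v (++⁺ (map⁺ proj₁ p) (concatMap-↭ proj₂ p))

dists-pairs : ∀ bs → concatMap dists bs ≡ map dist (concatMap branchPairs bs)
dists-pairs []              = refl
dists-pairs ((b , os) ∷ bs) = trans (cong₂ _++_ (map-∘ os) (dists-pairs bs)) (sym (map-++ dist (map (_, b) os) _))

lobePairs-All : ∀ {P : ℕ → Set} v bs → All P (lobeVertices (v , bs)) → All (λ (x , y) → P x × P y) (lobePairs (v , bs))
lobePairs-All {P} v bs (pv ∷ ps) = All.++⁺ (All.map⁺ (All.map (pv ,_) (All.++⁻ˡ (mids bs) ps)))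
                                       (branches bs (All.++⁻ˡ (mids bs) ps) (All.++⁻ʳ (mids bs) ps))
  where
  branches : ∀ bs → All P (mids bs) → All P (outs bs) → All (λ (x , y) → P x × P y) (concatMap branchPairs bs)
  branches []              []        qs = []
  branches ((b , os) ∷ bs) (pb ∷ ps) qs = All.++⁺ (All.map⁺ (All.map (_, pb) (All.++⁻ˡ os qs))) (branches bs ps (All.++⁻ʳ os qs))

-- The colour classes move separately: `φ` acts on the class of the centre, which contains the outer
-- vertices, and `ψ` on the middle vertices.
place : (ℕ → ℕ) → (ℕ → ℕ) → Branch → Branch
place φ ψ (b , os) = ψ b , map φ os

leaf : ℕ → Branch
leaf p = p , []

module _ (φ ψ : ℕ → ℕ) where

  mids-place : ∀ bs → mids (map (place φ ψ) bs) ≡ map ψ (mids bs)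
  mids-place []       = refl
  mids-place (b ∷ bs) = cong (_ ∷_) (mids-place bs)

  outs-place : ∀ bs → outs (map (place φ ψ) bs) ≡ map φ (outs bs)
  outs-place []              = refl
  outs-place ((b , os) ∷ bs) = trans (cong (map φ os ++_) (outs-place bs)) (sym (map-++ φ os _))

  sizes-place : ∀ bs → map size (map (place φ ψ) bs) ≡ map size bs
  sizes-place []              = refl
  sizes-place ((b , os) ∷ bs) = cong₂ _∷_ (length-map φ os) (sizes-place bs)

  pairs-place : ∀ v bs → lobePairs (φ v , map (place φ ψ) bs) ≡ map (λ (x , y) → φ x , ψ y) (lobePairs (v , bs))
  pairs-place v bs = trans (cong₂ _++_ (spokes bs) (branches bs)) (sym (map-++ _ (map (v ,_) (mids bs)) _))
    where
    F : ℕ × ℕ → ℕ × ℕ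
    F (x , y) = φ x , ψ y
    spokes : ∀ bs → map (φ v ,_) (mids (map (place φ ψ) bs)) ≡ map F (map (v ,_) (mids bs))
    spokes []       = refl
    spokes (b ∷ bs) = cong (_ ∷_) (spokes bs)
    branches : ∀ bs → concatMap branchPairs (map (place φ ψ) bs) ≡ map F (concatMap branchPairs bs)
    branches []              = refl
    branches ((b , os) ∷ bs) = trans (cong₂ _++_ (trans (sym (map-∘ os)) (map-∘ os)) (branches bs)) (sym (map-++ F (map (_, b) os) _))

leaves-sizes : ∀ ps → map size (map leaf ps) ≡ replicate (length ps) 0
leaves-sizes []       = refl
leaves-sizes (p ∷ ps) = cong (0 ∷_) (leaves-sizes ps)

leaves-mids : ∀ ps bs → mids (map leaf ps ++ bs) ≡ ps ++ mids bs
leaves-mids []       bs = refl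
leaves-mids (p ∷ ps) bs = cong (p ∷_) (leaves-mids ps bs)

leaves-concatMap : ∀ {A : Set} (f : Branch → List A) → (∀ p → f (leaf p) ≡ []) → ∀ ps bs →
                   concatMap f (map leaf ps ++ bs) ≡ concatMap f bs
leaves-concatMap f f[] []       bs = refl
leaves-concatMap f f[] (p ∷ ps) bs = trans (cong (_++ concatMap f (map leaf ps ++ bs)) (f[] p)) (leaves-concatMap f f[] ps bs)

-- A shape lists the numbers of outer vertices at the middle vertices of a lobe, a zero standing for
-- a pendant vertex; its `core` is the shape of the reduced lobe.
shapes : List Lobe → List (List ℕ)
shapes = map (map size ∘ proj₂)

core : List ℕ → List ℕ
core = filter (λ k → ¬? (k ≟ 0))

#pendants : List ℕ → ℕ
#pendants []          = 0
#pendants (zero  ∷ s) = suc (#pendants s)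
#pendants (suc k ∷ s) = #pendants s

split-core : ∀ s → replicate (#pendants s) 0 ++ core s ↭ s
split-core []          = ↭-refl
split-core (zero ∷ s)  = ↭-prep 0 (split-core s)
split-core (suc k ∷ s) = ↭-trans (shift (suc k) (replicate (#pendants s) 0) (core s)) (↭-prep (suc k) (split-core s))

-- Completes a translated reduced lobe, whose centre had label 0, by pendant vertices labelled `ps`.
-- Because shapes are matched up to order, one labelling serves both lobes of a pair.
dress : ∀ {s p ks} φ ψ bs ps → replicate p 0 ++ ks ↭ s → map size bs ≡ ks → length ps ≡ p →
  ∃ λ bs′ → map size bs′ ≡ s ×
    lobeVertices (φ 0 , bs′) ↭ φ 0 ∷ (ps ++ map ψ (mids bs)) ++ map φ (outs bs) ×
    lobeEdges (φ 0 , bs′) ↭ map ∣ φ 0 -_∣ ps ++ map (λ (x , y) → ∣ φ x - ψ y ∣) (lobePairs (0 , bs))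
dress {s} φ ψ bs ps perm refl refl = bs′ , sym sizes , vertices↭ , edges↭
  where
  open PermutationReasoning
  bs₀ = map leaf ps ++ map (place φ ψ) bs
  sizes₀ : map size bs₀ ≡ replicate (length ps) 0 ++ map size bs
  sizes₀ = trans (map-++ size (map leaf ps) _) (cong₂ _++_ (leaves-sizes ps) (sizes-place φ ψ bs))
  reorder = ↭-map-inv size {bs₀} {s} (subst (_↭ s) (sym sizes₀) perm)
  bs′ = proj₁ reorder
  sizes = proj₁ (proj₂ reorder)
  bs′↭ = ↭-sym (proj₂ (proj₂ reorder))
  vertices↭ = ↭-trans (lobeVertices-↭ (φ 0) bs′↭) (↭-reflexive (cong (φ 0 ∷_) (cong₂ _++_
    (trans (leaves-mids ps _) (cong (ps ++_) (mids-place φ ψ bs)))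
    (trans (leaves-concatMap proj₂ (λ _ → refl) ps _) (outs-place φ ψ bs)))))
  edges↭ : lobeEdges (φ 0 , bs′) ↭ map ∣ φ 0 -_∣ ps ++ map (λ (x , y) → ∣ φ x - ψ y ∣) (lobePairs (0 , bs))
  edges↭ = begin
    map dist (lobePairs (φ 0 , bs′)) ↭⟨ map⁺ dist (lobePairs-↭ (φ 0) bs′↭) ⟩
    map dist (map (φ 0 ,_) (mids bs₀) ++ concatMap branchPairs bs₀)
      ≡⟨ cong (map dist) (cong₂ _++_ (trans (cong (map _) (leaves-mids ps _)) (map-++ _ ps _))
            (leaves-concatMap branchPairs (λ _ → refl) ps _)) ⟩
    map dist ((map (φ 0 ,_) ps ++ map (φ 0 ,_) (mids (map (place φ ψ) bs))) ++ concatMap branchPairs (map (place φ ψ) bs))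
      ↭⟨ map⁺ dist (++-assoc (map (φ 0 ,_) ps) _ _) ⟩
    map dist (map (φ 0 ,_) ps ++ lobePairs (φ 0 , map (place φ ψ) bs))
      ≡⟨ cong (λ z → map dist (map (φ 0 ,_) ps ++ z)) (pairs-place φ ψ 0 bs) ⟩
    map dist (map (φ 0 ,_) ps ++ map (λ (x , y) → φ x , ψ y) (lobePairs (0 , bs)))
      ≡⟨ trans (map-++ dist (map (φ 0 ,_) ps) _) (cong₂ _++_ (sym (map-∘ ps)) (sym (map-∘ (lobePairs (0 , bs))))) ⟩
    map ∣ φ 0 -_∣ ps ++ map (λ (x , y) → ∣ φ x - ψ y ∣) (lobePairs (0 , bs)) ∎

far : ∀ {D x y} → x ≤ y → x ≤ D → ∣ x - (D + y) ∣ ≡ D + ∣ x - y ∣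
far {D} {x} {y} x≤y x≤D = trans (m≤n⇒∣m-n∣≡n∸m (≤-trans x≤D (m≤m+n D y)))
  (trans (+-∸-assoc D x≤y) (cong (D +_) (sym (m≤n⇒∣m-n∣≡n∸m x≤y))))

near : ∀ {D x y} → x ≤ y → y ≤ D → ∣ D + x - y ∣ ≡ D ∸ ∣ x - y ∣
near {D} {x} {y} x≤y y≤D = begin
  ∣ D + x - y ∣           ≡⟨ m≤n⇒∣n-m∣≡n∸m (≤-trans y≤D (m≤m+n D x)) ⟩
  D + x ∸ y               ≡⟨ cong₂ _∸_ (+-comm D x) (sym (m+[n∸m]≡n x≤y)) ⟩
  x + D ∸ (x + (y ∸ x))   ≡⟨ [m+n]∸[m+o]≡n∸o x D (y ∸ x) ⟩
  D ∸ (y ∸ x)             ≡⟨ cong (D ∸_) (m≤n⇒∣m-n∣≡n∸m x≤y) ⟨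
  D ∸ ∣ x - y ∣           ∎
  where open ≡-Reasoning

-- Raising the larger end of an edge by `D` turns its label d into D + d, raising the smaller end
-- turns it into D - d. The two copies raise opposite ends and so yield one label of each kind, but
-- which copy yields which depends on the edge.
mirrored : ∀ a D x y → x ≤ D → y ≤ D →
  (∣ a + x - (a + D + y) ∣ ≡ D + ∣ x - y ∣ × ∣ a + D + x - (a + y) ∣ ≡ D ∸ ∣ x - y ∣) ⊎
  (∣ a + x - (a + D + y) ∣ ≡ D ∸ ∣ x - y ∣ × ∣ a + D + x - (a + y) ∣ ≡ D + ∣ x - y ∣)
mirrored a D x y x≤D y≤D
  rewrite +-assoc a D y | +-assoc a D x | ∣m+n-m+o∣≡∣n-o∣ a x (D + y) | ∣m+n-m+o∣≡∣n-o∣ a (D + x) y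
  with ≤-total x y
... | inj₁ x≤y = inj₁ (far x≤y x≤D , near x≤y y≤D)
... | inj₂ y≤x = inj₂ (trans (∣-∣-comm x (D + y)) (trans (near y≤x x≤D) (cong (D ∸_) (∣-∣-comm y x)))
                     , trans (∣-∣-comm (D + x) y) (trans (far y≤x y≤D) (cong (D +_) (∣-∣-comm y x))))

map-++-map-swap : ∀ {A B : Set} {f g p q : A → B} {xs} →
  All (λ x → (f x ≡ p x × g x ≡ q x) ⊎ (f x ≡ q x × g x ≡ p x)) xs →
  map f xs ++ map g xs ↭ map p xs ++ map q xs
map-++-map-swap [] = ↭-refl
map-++-map-swap {f = f} {g} {p} {q} {x ∷ xs} (px ∷ pxs) = begin
  f x ∷ map f xs ++ g x ∷ map g xs   ↭⟨ ↭-prep (f x) (shift (g x) (map f xs) (map g xs)) ⟩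
  f x ∷ g x ∷ map f xs ++ map g xs   ↭⟨ heads px ⟩
  p x ∷ q x ∷ map f xs ++ map g xs   ↭⟨ ↭-prep (p x) (↭-prep (q x) (map-++-map-swap pxs)) ⟩
  p x ∷ q x ∷ map p xs ++ map q xs   ↭⟨ ↭-prep (p x) (shift (q x) (map p xs) (map q xs)) ⟨
  p x ∷ map p xs ++ q x ∷ map q xs   ∎
  where
  open PermutationReasoning
  heads : ∀ {zs} → _ → f x ∷ g x ∷ zs ↭ p x ∷ q x ∷ zs
  heads (inj₁ (e₁ , e₂)) = ↭-reflexive (cong₂ (λ u w → u ∷ w ∷ _) e₁ e₂)
  heads (inj₂ (e₁ , e₂)) = ↭-trans (↭-reflexive (cong₂ (λ u w → u ∷ w ∷ _) e₁ e₂)) (↭-swap _ _ ↭-refl)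

-- Labelling a lobster by induction, two lobes at a time.

data Good : List (List ℕ) → Set where
  []   : Good []
  one  : ∀ {s} → Odd (length (core s)) → Good (s ∷ [])
  pair : ∀ {s s′ ss} → Odd (length (core s)) → core s′ ↭ core s → Good ss → Good (s ∷ s′ ∷ ss)

-- The number of vertices: besides the centre, `length s` counts the middle vertices, pendant ones
-- included, and `sum s` the outer ones.
order : List (List ℕ) → ℕ
order []       = 0
order (s ∷ ss) = suc (length s + sum s) + order ss

order-core : ∀ s → length s + sum s ≡ #pendants s + (length (core s) + sum (core s))
order-core s = begin
  length s + sum s ≡⟨ cong₂ _+_ (↭-length (split-core s)) (sum-↭ (split-core s)) ⟨
  length (replicate p 0 ++ core s) + sum (replicate p 0 ++ core s)
    ≡⟨ cong₂ _+_ (trans (length-++ (replicate p 0)) (cong (_+ length (core s)) (length-replicate p)))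
                 (trans (sum-++ (replicate p 0) (core s)) (cong (_+ sum (core s)) (sum-zeros p))) ⟩
  p + length (core s) + sum (core s) ≡⟨ +-assoc p _ _ ⟩
  p + (length (core s) + sum (core s)) ∎
  where
  open ≡-Reasoning
  p = #pendants s
  sum-zeros : ∀ p → sum (replicate p 0) ≡ 0
  sum-zeros zero    = refl
  sum-zeros (suc p) = sum-zeros p

map-∣-∣-below : ∀ {c xs} → All (_≤ c) xs → map ∣ c -_∣ xs ≡ map (c ∸_) xs
map-∣-∣-below xs≤c = map-cong-local (All.map m≤n⇒∣n-m∣≡n∸m xs≤c)

map-∣-∣-above : ∀ a b n → map ∣ a -_∣ (iv (a + b) n) ≡ iv b n
map-∣-∣-above a b n = trans (cong (map ∣ a -_∣) (sym (map-+-iv a b n)))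
  (trans (sym (map-∘ (iv b n))) (map-id-local (All.universal (∣m-m+n∣≡n a) (iv b n))))

core-edges↭ : ∀ bs → lobeEdges (0 , bs) ↭ mids bs ++ concatMap dists bs
core-edges↭ bs = ↭-reflexive (trans (map-++ dist (map (0 ,_) (mids bs)) _)
  (cong₂ _++_ (trans (sym (map-∘ (mids bs))) (map-id-local (All.universal (λ _ → refl) (mids bs)))) (sym (dists-pairs bs))))

module _ where
  open import Algebra.Solver.CommutativeMonoid (↭-commutativeMonoid ℕ) using (solve; _⊜_; _⊕_) renaming (id to ε)
  open PermutationReasoning

  -- The last summand lists the differences along the spine, preceded by a further spinal vertex
  -- whose label a + N lies just above the interval: this is the edge to the preceding pair of lobes.
  lobsterLabelling : ∀ ss → Good ss → ∀ a → let N = order ss in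
    ∃ λ LL → shapes LL ≡ ss × concatMap lobeVertices LL ↭ iv a N ×
      concatMap lobeEdges LL ++ links (a + N ∷ spine LL) ↭ iv 1 N
  lobsterLabelling []       []        a = [] , refl , ↭-refl , ↭-refl
  lobsterLabelling (s ∷ []) (one odd) a
    with reducedLobeLabelling (core s) (All.all-filter _ s) odd
  ... | bs , sizes , vs , es
    -- The pendant vertices sit just above the translated reduced lobe, so their edge labels
    -- continue 1, ..., e; the edge to the preceding spinal vertex adds the largest label.
    with dress {s} (a +_) (a +_) bs (iv (a + suc (length (core s) + sum (core s))) (#pendants s))
           (split-core s) sizes (length-iv _ _)
  ... | bs′ , sizes′ , vs′ , es′ = (a + 0 , bs′) ∷ [] , cong [_] sizes′ , vertices↭ , edges↭
    where
    e = length (core s) + sum (core s)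
    p = #pendants s
    ps = iv (a + suc e) p
    N≡ : order (s ∷ []) ≡ suc (e + p)
    N≡ = trans (+-identityʳ _) (cong suc (trans (order-core s) (+-comm p e)))
    vertices↭ : lobeVertices (a + 0 , bs′) ++ [] ↭ iv a (order (s ∷ []))
    vertices↭ = begin
      lobeVertices (a + 0 , bs′) ++ [] ↭⟨ ++⁺ʳ [] vs′ ⟩
      (a + 0 ∷ (ps ++ map (a +_) (mids bs)) ++ map (a +_) (outs bs)) ++ []
        ↭⟨ solve 4 (λ v p m o → (v ⊕ ((p ⊕ m) ⊕ o)) ⊕ ε ⊜ (v ⊕ (m ⊕ o)) ⊕ p) ↭-refl
             [ a + 0 ] ps (map (a +_) (mids bs)) (map (a +_) (outs bs)) ⟩
      (a + 0 ∷ map (a +_) (mids bs) ++ map (a +_) (outs bs)) ++ ps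
        ≡⟨ cong (_++ ps) (cong (a + 0 ∷_) (map-++ (a +_) (mids bs) (outs bs))) ⟨
      map (a +_) (0 ∷ mids bs ++ outs bs) ++ ps ↭⟨ ++⁺ʳ ps (map⁺ (a +_) vs) ⟩
      map (a +_) (iv 0 (suc e)) ++ ps ≡⟨ cong (_++ ps) (trans (map-+-iv a 0 (suc e)) (cong (λ z → iv z (suc e)) (+-identityʳ a))) ⟩
      iv a (suc e) ++ iv (a + suc e) p ≡⟨ iv-++ a (suc e) p ⟨
      iv a (suc e + p) ≡⟨ cong (iv a) N≡ ⟨
      iv a (order (s ∷ [])) ∎
    edges↭ : (lobeEdges (a + 0 , bs′) ++ []) ++ ∣ a + order (s ∷ []) - (a + 0) ∣ ∷ [] ↭ iv 1 (order (s ∷ []))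
    edges↭ = begin
      (lobeEdges (a + 0 , bs′) ++ []) ++ [ ∣ a + order (s ∷ []) - (a + 0) ∣ ]
        ↭⟨ ++⁺ (++⁺ʳ [] es′) (↭-reflexive (cong [_] (trans (∣m+n-m+o∣≡∣n-o∣ a _ 0) (trans (∣-∣-identityʳ _) N≡)))) ⟩
      ((map ∣ a + 0 -_∣ ps ++ map (λ (x , y) → ∣ a + x - (a + y) ∣) (lobePairs (0 , bs))) ++ []) ++ [ suc (e + p) ]
        ≡⟨ cong (λ z → (z ++ []) ++ [ suc (e + p) ]) (cong₂ _++_
             (trans (cong (λ z → map ∣ z -_∣ ps) (+-identityʳ a)) (map-∣-∣-above a (suc e) p))
             (map-cong (λ (x , y) → ∣m+n-m+o∣≡∣n-o∣ a x y) (lobePairs (0 , bs)))) ⟩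
      ((iv (suc e) p ++ lobeEdges (0 , bs)) ++ []) ++ [ suc (e + p) ]
        ↭⟨ ++⁺ʳ [ suc (e + p) ] (++⁺ʳ [] (++⁺ˡ (iv (suc e) p) (↭-trans (core-edges↭ bs) es))) ⟩
      ((iv (suc e) p ++ iv 1 e) ++ []) ++ [ suc (e + p) ]
        ↭⟨ solve 3 (λ p e n → ((p ⊕ e) ⊕ ε) ⊕ n ⊜ n ⊕ (e ⊕ p)) ↭-refl (iv (suc e) p) (iv 1 e) [ suc (e + p) ] ⟩
      suc (e + p) ∷ iv 1 e ++ iv (suc e) p ≡⟨ cong (suc (e + p) ∷_) (iv-++ 1 e p) ⟨
      suc (e + p) ∷ iv 1 (e + p)  ↭⟨ iv-suc 1 (e + p) ⟨
      iv 1 (suc (e + p))          ≡⟨ cong (iv 1) N≡ ⟨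
      iv 1 (order (s ∷ []))       ∎
  lobsterLabelling (s ∷ s′ ∷ ss) (pair odd similar good) a
    with reducedLobeLabelling (core s) (All.all-filter _ s) odd
  ... | bs , sizes , vs , es = result
    where
    e = length (core s) + sum (core s)
    n = suc e
    p₁ = #pendants s
    p₂ = #pendants s′
    R = order ss
    -- The lower block of `n` labels is followed by the pendant vertices of the second centre and by
    -- the `R` labels of the remaining lobes; then the upper block starts, at `c`.
    D = n + p₂ + R
    c = a + D
    ps₁ = iv (c + n) p₁
    ps₂ = iv (a + n) p₂
    -- As `a′ + R` equals `c`, the preceding spinal vertex in the recursive call is the second
    -- centre.
    a′ = a + n + p₂
    order≡ : order (s ∷ s′ ∷ ss) ≡ D + n + p₁
    order≡ = trans (cong₂ (λ u w → suc u + (suc w + R)) (order-core s) (trans (order-core s′)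
               (cong (p₂ +_) (cong₂ _+_ (↭-length similar) (sum-↭ similar))))) (l p₁ e p₂ R)
      where
      l : ∀ p₁ e p₂ R → suc (p₁ + e) + (suc (p₂ + e) + R) ≡ (suc e + p₂ + R) + suc e + p₁
      l = solve-∀
    -- The first copy has the class of its centre in the lower block; `second` exchanges the blocks,
    -- so that its centre gets the label `c`.
    first = dress {s} (a +_) (c +_) bs ps₁ (split-core s) sizes (length-iv _ _)
    second = dress {s′} (c +_) (a +_) bs ps₂ (↭-trans (++⁺ˡ (replicate p₂ 0) (↭-sym similar)) (split-core s′)) sizes (length-iv _ _)
    rest = lobsterLabelling ss good a′
    bs₁ = proj₁ first
    bs₂ = proj₁ second
    LL = proj₁ rest
    ivs : ∀ {x m b} k → x + m ≡ b → iv x (m + k) ≡ iv x m ++ iv b k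
    ivs {x} {m} k eq = trans (iv-++ x m k) (cong (λ b → iv x m ++ iv b k) eq)
    M = mids bs
    O = outs bs
    copy : ∀ x → x + 0 ∷ map (x +_) M ++ map (x +_) O ↭ iv x n
    copy x = begin
      x + 0 ∷ map (x +_) M ++ map (x +_) O ≡⟨ cong (x + 0 ∷_) (map-++ (x +_) M O) ⟨
      map (x +_) (0 ∷ M ++ O)              ↭⟨ map⁺ (x +_) vs ⟩
      map (x +_) (iv 0 n)                  ≡⟨ trans (map-+-iv x 0 n) (cong (λ z → iv z n) (+-identityʳ x)) ⟩
      iv x n                               ∎
    vertices↭ : concatMap lobeVertices ((a + 0 , bs₁) ∷ (c + 0 , bs₂) ∷ LL) ↭ iv a (order (s ∷ s′ ∷ ss))
    vertices↭ = begin
      lobeVertices (a + 0 , bs₁) ++ lobeVertices (c + 0 , bs₂) ++ concatMap lobeVertices LL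
        ↭⟨ ++⁺ (proj₁ (proj₂ (proj₂ first))) (++⁺ (proj₁ (proj₂ (proj₂ second))) (proj₁ (proj₂ (proj₂ rest)))) ⟩
      (a + 0 ∷ (ps₁ ++ map (c +_) M) ++ map (a +_) O) ++ (c + 0 ∷ (ps₂ ++ map (a +_) M) ++ map (c +_) O) ++ iv a′ R
        ↭⟨ solve 9 (λ a₀ c₀ p q aM cM aO cO r →
             (a₀ ⊕ ((p ⊕ cM) ⊕ aO)) ⊕ ((c₀ ⊕ ((q ⊕ aM) ⊕ cO)) ⊕ r) ⊜
             (a₀ ⊕ (aM ⊕ aO)) ⊕ (q ⊕ (r ⊕ ((c₀ ⊕ (cM ⊕ cO)) ⊕ p)))) ↭-refl
             [ a + 0 ] [ c + 0 ] ps₁ ps₂ (map (a +_) M) (map (c +_) M) (map (a +_) O) (map (c +_) O) (iv a′ R) ⟩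
      (a + 0 ∷ map (a +_) M ++ map (a +_) O) ++ ps₂ ++ iv a′ R ++ (c + 0 ∷ map (c +_) M ++ map (c +_) O) ++ ps₁
        ↭⟨ ++⁺ (copy a) (++⁺ˡ ps₂ (++⁺ˡ (iv a′ R) (++⁺ʳ ps₁ (copy c)))) ⟩
      iv a n ++ iv (a + n) p₂ ++ iv a′ R ++ iv c n ++ iv (c + n) p₁
        ≡⟨ cong (λ z → iv a n ++ iv (a + n) p₂ ++ iv a′ R ++ z) (iv-++ c n p₁) ⟨
      iv a n ++ iv (a + n) p₂ ++ iv a′ R ++ iv c (n + p₁)
        ≡⟨ cong (λ z → iv a n ++ iv (a + n) p₂ ++ z) (ivs (n + p₁) (l a n p₂ R)) ⟨
      iv a n ++ iv (a + n) p₂ ++ iv a′ (R + (n + p₁))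
        ≡⟨ cong (iv a n ++_) (iv-++ (a + n) p₂ _) ⟨
      iv a n ++ iv (a + n) (p₂ + (R + (n + p₁)))
        ≡⟨ iv-++ a n _ ⟨
      iv a (n + (p₂ + (R + (n + p₁)))) ≡⟨ cong (iv a) (trans (l′ n p₂ R p₁) (sym order≡)) ⟩
      iv a (order (s ∷ s′ ∷ ss)) ∎
      where
      l : ∀ a n p r → a + n + p + r ≡ a + (n + p + r)
      l = solve-∀
      l′ : ∀ n p₂ R p₁ → n + (p₂ + (R + (n + p₁))) ≡ n + p₂ + R + n + p₁
      l′ = solve-∀
    T = lobePairs (0 , bs)
    F = map (λ (x , y) → ∣ a + x - (c + y) ∣) T
    G = map (λ (x , y) → ∣ c + x - (a + y) ∣) T
    T≤ : All (λ (x , y) → x ≤ D × y ≤ D) T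
    T≤ = lobePairs-All 0 bs (All-resp-↭ (↭-sym vs) (iv-upper 0 n (≤-trans (≤-trans (m≤m+n n p₂) (m≤m+n (n + p₂) R)) (n≤1+n D))))
    -- The two copies together give every label within `e` of `D` except `D` itself, which is left
    -- to the edge joining the centres.
    FG : F ++ G ↭ iv (D + 1) e ++ iv (suc (p₂ + R)) e
    FG = begin
      F ++ G
        ↭⟨ map-++-map-swap (All.map (λ {(x , y)} (x≤D , y≤D) → mirrored a D x y x≤D y≤D) T≤) ⟩
      map (λ t → D + dist t) T ++ map (λ t → D ∸ dist t) T
        ≡⟨ cong₂ _++_ (map-∘ T) (map-∘ T) ⟩
      map (D +_) (map dist T) ++ map (D ∸_) (map dist T)
        ↭⟨ ++⁺ (map⁺ (D +_) edges₀) (map⁺ (D ∸_) edges₀) ⟩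
      map (D +_) (iv 1 e) ++ map (D ∸_) (iv 1 e)
        ↭⟨ ++⁺ (↭-reflexive (map-+-iv D 1 e)) (map-∸-iv 1 (suc (p₂ + R)) e (l p₂ R e)) ⟩
      iv (D + 1) e ++ iv (suc (p₂ + R)) e ∎
      where
      edges₀ : map dist T ↭ iv 1 e
      edges₀ = ↭-trans (core-edges↭ bs) es
      l : ∀ p r e → 1 + suc (p + r) + e ≡ suc (suc e + p + r)
      l = solve-∀
    pendants₁ : map ∣ a + 0 -_∣ ps₁ ≡ iv (D + n) p₁
    pendants₁ = trans (cong₂ (λ u w → map ∣ u -_∣ (iv w p₁)) (+-identityʳ a) (+-assoc a D n)) (map-∣-∣-above a (D + n) p₁)
    -- These lie between the lower block and the remaining interval of length `R`, so their
    -- distances to `c` start at `suc R`.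
    pendants₂ : map ∣ c + 0 -_∣ ps₂ ↭ iv (suc R) p₂
    pendants₂ = begin
      map ∣ c + 0 -_∣ ps₂ ≡⟨ cong (λ z → map ∣ z -_∣ ps₂) (+-identityʳ c) ⟩
      map ∣ c -_∣ ps₂     ≡⟨ map-∣-∣-below (iv-upper (a + n) p₂ (≤-trans (m≤m+n (a + n + p₂) R) (≤-trans (≤-reflexive (l a n p₂ R)) (n≤1+n c)))) ⟩
      map (c ∸_) ps₂      ↭⟨ map-∸-iv (a + n) (suc R) p₂ (l′ a n p₂ R) ⟩
      iv (suc R) p₂       ∎
      where
      l : ∀ a n p r → a + n + p + r ≡ a + (n + p + r)
      l = solve-∀
      l′ : ∀ a n p r → a + n + suc r + p ≡ suc (a + (n + p + r))
      l′ = solve-∀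
    N = D + n + p₁
    links≡ : links (a + order (s ∷ s′ ∷ ss) ∷ a + 0 ∷ c + 0 ∷ spine LL) ≡ N ∷ D ∷ links (a′ + R ∷ spine LL)
    links≡ = cong₂ _∷_ (trans (∣m+n-m+o∣≡∣n-o∣ a _ 0) (trans (∣-∣-identityʳ _) order≡))
      (cong₂ _∷_ (trans (cong (∣ a + 0 -_∣) (+-identityʳ c)) (trans (∣m+n-m+o∣≡∣n-o∣ a 0 D) refl))
                 (cong (λ z → links (z ∷ spine LL)) (trans (+-identityʳ c) (l a n p₂ R))))
      where
      l : ∀ a n p r → a + (n + p + r) ≡ a + n + p + r
      l = solve-∀
    -- From the bottom up: the recursive call, the pendant edges at the second centre, the labels D
    -- - d, the edge `D` joining the centres, the labels D + d, the pendant edges at the first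
    -- centre, and `N` for the edge to the preceding spinal vertex.
    edges↭ : concatMap lobeEdges ((a + 0 , bs₁) ∷ (c + 0 , bs₂) ∷ LL) ++ links (a + order (s ∷ s′ ∷ ss) ∷ a + 0 ∷ c + 0 ∷ spine LL)
            ↭ iv 1 (order (s ∷ s′ ∷ ss))
    edges↭ = begin
      (lobeEdges (a + 0 , bs₁) ++ lobeEdges (c + 0 , bs₂) ++ concatMap lobeEdges LL) ++
        links (a + order (s ∷ s′ ∷ ss) ∷ a + 0 ∷ c + 0 ∷ spine LL)
        ↭⟨ ++⁺ (++⁺ (↭-trans (proj₂ (proj₂ (proj₂ first))) (++⁺ʳ F (↭-reflexive pendants₁)))
                    (++⁺ʳ _ (↭-trans (proj₂ (proj₂ (proj₂ second))) (++⁺ʳ G pendants₂)))) (↭-reflexive links≡) ⟩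
      ((iv (D + n) p₁ ++ F) ++ (iv (suc R) p₂ ++ G) ++ concatMap lobeEdges LL) ++ N ∷ D ∷ links (a′ + R ∷ spine LL)
        ↭⟨ solve 8 (λ p f q g r N D L →
             ((p ⊕ f) ⊕ ((q ⊕ g) ⊕ r)) ⊕ (N ⊕ (D ⊕ L)) ⊜ (r ⊕ L) ⊕ (q ⊕ ((f ⊕ g) ⊕ (D ⊕ (p ⊕ N))))) ↭-refl
             (iv (D + n) p₁) F (iv (suc R) p₂) G (concatMap lobeEdges LL) [ N ] [ D ] (links (a′ + R ∷ spine LL)) ⟩
      (concatMap lobeEdges LL ++ links (a′ + R ∷ spine LL)) ++ iv (suc R) p₂ ++ (F ++ G) ++ D ∷ iv (D + n) p₁ ++ [ N ]
        ↭⟨ ++⁺ (proj₂ (proj₂ (proj₂ rest))) (++⁺ˡ (iv (suc R) p₂) (++⁺ʳ _ FG)) ⟩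
      iv 1 R ++ iv (suc R) p₂ ++ (iv (D + 1) e ++ iv (suc (p₂ + R)) e) ++ D ∷ iv (D + n) p₁ ++ [ N ]
        ↭⟨ ++⁺ˡ (iv 1 R) (++⁺ˡ (iv (suc R) p₂) (solve 5 (λ u w D p N →
             (u ⊕ w) ⊕ (D ⊕ (p ⊕ N)) ⊜ w ⊕ ((D ⊕ u) ⊕ (p ⊕ N))) ↭-refl
             (iv (D + 1) e) (iv (suc (p₂ + R)) e) [ D ] (iv (D + n) p₁) [ N ])) ⟩
      iv 1 R ++ iv (suc R) p₂ ++ iv (suc (p₂ + R)) e ++ (D ∷ iv (D + 1) e) ++ iv (D + n) p₁ ++ iv N 1
        ≡⟨ cong (λ z → iv 1 R ++ iv (suc R) p₂ ++ iv (suc (p₂ + R)) e ++ (D ∷ iv z e) ++ iv (D + n) p₁ ++ iv N 1) (+-comm D 1) ⟩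
      iv 1 R ++ iv (suc R) p₂ ++ iv (suc (p₂ + R)) e ++ iv D n ++ iv (D + n) p₁ ++ iv N 1
        ≡⟨ cong (λ z → iv 1 R ++ iv (suc R) p₂ ++ iv (suc (p₂ + R)) e ++ iv D n ++ z) (iv-++ (D + n) p₁ 1) ⟨
      iv 1 R ++ iv (suc R) p₂ ++ iv (suc (p₂ + R)) e ++ iv D n ++ iv (D + n) (p₁ + 1)
        ≡⟨ cong (λ z → iv 1 R ++ iv (suc R) p₂ ++ iv (suc (p₂ + R)) e ++ z) (iv-++ D n (p₁ + 1)) ⟨
      iv 1 R ++ iv (suc R) p₂ ++ iv (suc (p₂ + R)) e ++ iv D (n + (p₁ + 1))
        ≡⟨ cong (λ z → iv 1 R ++ iv (suc R) p₂ ++ z) (ivs _ (l₂ p₂ R e)) ⟨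
      iv 1 R ++ iv (suc R) p₂ ++ iv (suc (p₂ + R)) (e + (n + (p₁ + 1)))
        ≡⟨ cong (iv 1 R ++_) (ivs _ (l₁ R p₂)) ⟨
      iv 1 R ++ iv (suc R) (p₂ + (e + (n + (p₁ + 1))))
        ≡⟨ iv-++ 1 R _ ⟨
      iv 1 (R + (p₂ + (e + (n + (p₁ + 1))))) ≡⟨ cong (iv 1) (trans (l₃ R p₂ e p₁) (sym order≡)) ⟩
      iv 1 (order (s ∷ s′ ∷ ss)) ∎
      where
      l₁ : ∀ R p → suc R + p ≡ suc (p + R)
      l₁ = solve-∀
      l₂ : ∀ p R e → suc (p + R) + e ≡ suc e + p + R
      l₂ = solve-∀
      l₃ : ∀ R p e q → R + (p + (e + (suc e + (q + 1)))) ≡ suc e + p + R + suc e + q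
      l₃ = solve-∀
    result : ∃ λ LL → shapes LL ≡ s ∷ s′ ∷ ss × concatMap lobeVertices LL ↭ iv a (order (s ∷ s′ ∷ ss)) ×
      concatMap lobeEdges LL ++ links (a + order (s ∷ s′ ∷ ss) ∷ spine LL) ↭ iv 1 (order (s ∷ s′ ∷ ss))
    result = (a + 0 , bs₁) ∷ (c + 0 , bs₂) ∷ LL
           , cong₂ _∷_ (proj₁ (proj₂ first)) (cong₂ _∷_ (proj₁ (proj₂ second)) (proj₁ (proj₂ rest)))
           , vertices↭ , edges↭

-- From lists of labels to a labelling of positions.

Unique-resp-↭ : ∀ {A : Set} {xs ys : List A} → xs ↭ ys → Unique xs → Unique ys
Unique-resp-↭ {A} p = ↭ₛ.Unique-resp-↭ (setoid A) (↭⇒↭ₛ p)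

unique-map-injective : ∀ {A B : Set} {f : A → B} {xs x y} → Unique (map f xs) → x ∈ xs → y ∈ xs → f x ≡ f y → x ≡ y
unique-map-injective         (_ ∷ _)  (here refl) (here refl) eq = refl
unique-map-injective {f = f} (x≢ ∷ _)  (here refl) (there y∈)  eq = contradiction eq (All.lookup x≢ (∈-map⁺ f y∈))
unique-map-injective {f = f} (x≢ ∷ _)  (there x∈)  (here refl) eq = contradiction (sym eq) (All.lookup x≢ (∈-map⁺ f x∈))
unique-map-injective         (_ ∷ u)  (there x∈)  (there y∈)  eq = unique-map-injective u x∈ y∈ eq

map≡tabulate⁻ : ∀ {A B : Set} (f : A → B) {n} (h : Fin n → B) xs → map f xs ≡ tabulate h →
                ∃ λ e → xs ≡ tabulate e × ∀ i → f (e i) ≡ h i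
map≡tabulate⁻ f {zero}  h []       eq = (λ ()) , refl , λ ()
map≡tabulate⁻ f {suc n} h (x ∷ xs) eq with ∷-injective eq
... | fx≡ , eq′ with map≡tabulate⁻ f (h ∘ suc) xs eq′
...   | e , refl , pw = (λ { zero → x ; (suc i) → e i }) , refl , λ { zero → fx≡ ; (suc i) → pw i }

length≡⇒tabulate : ∀ {A : Set} (xs : List A) {n} → length xs ≡ n → ∃ λ (c : Fin n → A) → xs ≡ tabulate c
length≡⇒tabulate xs refl = lookup xs , sym (tabulate-lookup xs)

module _ {r : ℕ} {s : Fin r → ℕ} {k : (i : Fin r) → Fin (s i) → ℕ} where

  assemble : (a : Fin r → ℕ) (b : ∀ i → Fin (s i) → ℕ) (c : ∀ i j → Fin (k i j) → ℕ) → List Lobe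
  assemble a b c = tabulate λ i → a i , tabulate λ j → b i j , tabulate (c i j)

  -- The equation of shapes fixes the lengths of all nested lists, so the labels can be read off as
  -- functions of the indices of a `Position`.
  disassemble : ∀ LL → shapes LL ≡ tabulate (λ i → tabulate (k i)) →
    ∃ λ a → ∃₂ λ b c → LL ≡ assemble a b c
  disassemble LL eq with map≡tabulate⁻ (map size ∘ proj₂) _ LL eq
  ... | e , refl , pw = proj₁ ∘ e , (λ i → proj₁ ∘ branches i) , (λ i j → proj₁ (leaves i j))
      , tabulate-cong λ i → cong (proj₁ (e i) ,_) (trans (proj₁ (proj₂ (inverse i)))
          (tabulate-cong λ j → cong (proj₁ (branches i j) ,_) (proj₂ (leaves i j))))
    where
    inverse  = λ i → map≡tabulate⁻ size (k i) (proj₂ (e i)) (pw i)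
    branches = λ i → proj₁ (inverse i)
    leaves   = λ i j → length≡⇒tabulate (proj₂ (branches i j)) (proj₂ (proj₂ (inverse i)) j)

module _ (r : ℕ) (s : Fin r → ℕ) (k : (i : Fin r) → Fin (s i) → ℕ) where

  Pos : Set
  Pos = Position r s k

  -- Enumerated in the order of `lobeVertices`, so that applying the labelling gives that very list.
  lobePositions : Fin r → List Pos
  lobePositions i = spinal i ∷ tabulate (middle i) ++ concat (tabulate λ j → tabulate (outer i j))

  positions : List Pos
  positions = concat (tabulate lobePositions)

  positions-complete : ∀ p → p ∈ positions
  positions-complete p = ∈-concat⁺′ (in-lobe p) (∈-tabulate⁺ (lobeOf p))
    where
    lobeOf : Pos → Fin r
    lobeOf (spinal i)    = i
    lobeOf (middle i _)  = i
    lobeOf (outer i _ _) = i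
    in-lobe : ∀ p → p ∈ lobePositions (lobeOf p)
    in-lobe (spinal i)    = here refl
    in-lobe (middle i j)  = there (∈-++⁺ˡ (∈-tabulate⁺ j))
    in-lobe (outer i j l) = there (∈-++⁺ʳ (tabulate (middle i)) (∈-concat⁺′ (∈-tabulate⁺ l) (∈-tabulate⁺ j)))

  -- The order is that of `lobePairs`, but outer edges are directed as in `toOuter`, opposite to
  -- `branchPairs`.
  lobeLinks : Fin r → List (Pos × Pos)
  lobeLinks i = tabulate (λ j → spinal i , middle i j) ++ concat (tabulate λ j → tabulate λ l → middle i j , outer i j l)

spineLinks : ∀ r s k → List (Pos r s k × Pos r s k)
spineLinks zero    s k = []
spineLinks (suc r) s k = tabulate λ i → spinal (inject₁ i) , spinal (suc i)

allLinks : ∀ r s k → List (Pos r s k × Pos r s k)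
allLinks r s k = concat (tabulate (lobeLinks r s k)) ++ spineLinks r s k

allLinks-complete : ∀ r s k {p q} → Link r s k p q → (p , q) ∈ allLinks r s k
allLinks-complete (suc r) s k (along i (suc i′) eq) = ∈-++⁺ʳ (concat (tabulate (lobeLinks (suc r) s k)))
  (subst (λ i → (spinal i , spinal (suc i′)) ∈ spineLinks (suc r) s k)
    (toℕ-injective (trans (toℕ-inject₁ i′) (suc-injective eq))) (∈-tabulate⁺ i′))
allLinks-complete r s k (toMiddle i j) = ∈-++⁺ˡ (∈-concat⁺′ (∈-++⁺ˡ (∈-tabulate⁺ j)) (∈-tabulate⁺ i))
allLinks-complete r s k (toOuter i j l) = ∈-++⁺ˡ (∈-concat⁺′
  (∈-++⁺ʳ (tabulate λ j → spinal i , middle i j) (∈-concat⁺′ (∈-tabulate⁺ l) (∈-tabulate⁺ j))) (∈-tabulate⁺ i))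

allLinks-sound : ∀ r s k {p q} → (p , q) ∈ allLinks r s k → Link r s k p q
allLinks-sound r s k pq∈ with ∈-++⁻ (concat (tabulate (lobeLinks r s k))) pq∈
allLinks-sound (suc r) s k pq∈ | inj₂ pq∈′ with ∈-tabulate⁻ pq∈′
... | i , refl = along (inject₁ i) (suc i) (cong suc (sym (toℕ-inject₁ i)))
allLinks-sound r s k pq∈ | inj₁ pq∈′ with ∈-concat⁻′ (tabulate (lobeLinks r s k)) pq∈′
... | _ , pq∈″ , ∈t with ∈-tabulate⁻ ∈t
...   | i , refl with ∈-++⁻ (tabulate λ j → spinal i , middle i j) pq∈″
...     | inj₁ pq∈‴ with ∈-tabulate⁻ pq∈‴
...       | j , refl = toMiddle i j
allLinks-sound r s k pq∈ | inj₁ pq∈′ | _ , pq∈″ , ∈t | i , refl | inj₂ pq∈‴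
  with ∈-concat⁻′ (tabulate λ j → tabulate λ l → middle i j , outer i j l) pq∈‴
...  | _ , pq∈⁗ , ∈t′ with ∈-tabulate⁻ ∈t′
...    | j , refl with ∈-tabulate⁻ pq∈⁗
...      | l , refl = toOuter i j l

links-tabulate : ∀ {r} (a : Fin (suc r) → ℕ) → links (tabulate a) ≡ tabulate λ i → ∣ a (inject₁ i) - a (suc i) ∣
links-tabulate {zero}  a = refl
links-tabulate {suc r} a = cong (∣ a zero - a (suc zero) ∣ ∷_) (links-tabulate (a ∘ suc))

-- Gracefulness with links in place of the edges of a graph.
record PositionLabelling (r : ℕ) (s : Fin r → ℕ) (k : (i : Fin r) → Fin (s i) → ℕ) : Set where
  field
    label         : Position r s k → ℕ
    injective     : ∀ p q → label p ≡ label q → p ≡ q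
    bounded       : ∀ p → label p ≤ length (allLinks r s k)
    unique-labels : Unique (map (λ (p , q) → ∣ label p - label q ∣) (allLinks r s k))

positionLabelling : ∀ r s k → r ≥ 1 → Good (tabulate λ i → tabulate (k i)) → PositionLabelling r s k
positionLabelling (suc r) s k _ good with lobsterLabelling ss good 0
  where
  ss = tabulate λ i → tabulate (k i)
... | LL , shapes≡ , vertices↭ , edges↭ with disassemble {k = k} LL shapes≡
...   | a , b , c , refl = record
  { label         = g
  ; injective     = λ p q → unique-map-injective (subst Unique (sym map-g) (Unique-resp-↭ (↭-sym vertices↭) (iv-unique 0 N)))
                               (positions-complete (suc r) s k p) (positions-complete (suc r) s k q)
  ; bounded       = λ p → All.lookup (iv-upper 0 N (≤-reflexive N≡)) (∈-resp-↭ vertices↭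
                    (subst (g p ∈_) map-g (∈-map⁺ g (positions-complete (suc r) s k p))))
  ; unique-labels = subst Unique (sym map-F) unique-W
  }
  where
  LLs = assemble {k = k} a b c
  N = order (tabulate λ i → tabulate (k i))
  P = Position (suc r) s k
  g : P → ℕ
  g (spinal i)    = a i
  g (middle i j)  = b i j
  g (outer i j l) = c i j l
  F : P × P → ℕ
  F (p , q) = ∣ g p - g q ∣
  W = concatMap lobeEdges LLs ++ links (spine LLs)
  spine≡ : spine LLs ≡ tabulate a
  spine≡ = map-tabulate (λ i → a i , tabulate λ j → b i j , tabulate (c i j)) proj₁
  -- The entry `x` belongs to the fictitious edge in front of the first spinal vertex; removing it
  -- leaves the actual edge labels `W`.
  W↭ : ∃ λ x → x ∷ W ↭ iv 1 N
  W↭ = _ , ↭-trans (↭-sym (shift _ (concatMap lobeEdges LLs) (links (spine LLs)))) edges↭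
  unique-W : Unique W
  unique-W with Unique-resp-↭ (↭-sym (proj₂ W↭)) (iv-unique 1 N)
  ... | _ ∷ u = u
  lobe-positions : ∀ i → map g (lobePositions (suc r) s k i) ≡
                         lobeVertices (a i , tabulate λ j → b i j , tabulate (c i j))
  lobe-positions i = cong (a i ∷_) (trans (map-++ g (tabulate (middle i)) _) (cong₂ _++_
    (trans (map-tabulate (middle i) g) (sym (map-tabulate (λ j → b i j , tabulate (c i j)) proj₁)))
    (trans (sym (concat-map (tabulate λ j → tabulate (outer i j)))) (cong concat
      (trans (map-tabulate (λ j → tabulate (outer i j)) (map g)) (trans (tabulate-cong λ j → map-tabulate (outer i j) g)
      (sym (map-tabulate (λ j → b i j , tabulate (c i j)) proj₂))))))))
  map-g : map g (positions (suc r) s k) ≡ concatMap lobeVertices LLs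
  map-g = trans (sym (concat-map (tabulate (lobePositions (suc r) s k)))) (cong concat
    (trans (map-tabulate (lobePositions (suc r) s k) (map g)) (trans (tabulate-cong lobe-positions)
      (sym (map-tabulate (λ i → a i , tabulate λ j → b i j , tabulate (c i j)) lobeVertices)))))
  lobe-links : ∀ i → map F (lobeLinks (suc r) s k i) ≡ lobeEdges (a i , tabulate λ j → b i j , tabulate (c i j))
  lobe-links i = trans (map-++ F (tabulate λ j → spinal i , middle i j) _) (trans (cong₂ _++_
    (trans (map-tabulate (λ j → spinal i , middle i j) F)
      (sym (trans (cong (map dist ∘ map (a i ,_)) (map-tabulate (λ j → b i j , tabulate (c i j)) proj₁))
           (trans (cong (map dist) (map-tabulate (b i) (a i ,_))) (map-tabulate _ dist)))))
    (trans (sym (concat-map (tabulate λ j → tabulate λ l → middle i j , outer i j l)))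
      (trans (cong concat (trans (map-tabulate (λ j → tabulate λ l → middle i j , outer i j l) (map F))
        (trans (tabulate-cong λ j → trans (map-tabulate (λ l → middle i j , outer i j l) F)
            (sym (trans (cong (map dist) (map-tabulate (c i j) (_, b i j)))
              (trans (map-tabulate _ dist) (tabulate-cong λ l → ∣-∣-comm (c i j l) (b i j))))))
          (trans (sym (map-tabulate (λ j → branchPairs (b i j , tabulate (c i j))) (map dist)))
            (cong (map (map dist)) (sym (map-tabulate (λ j → b i j , tabulate (c i j)) branchPairs)))))))
        (concat-map (map branchPairs (tabulate λ j → b i j , tabulate (c i j)))))))
    (sym (map-++ dist (map (a i ,_) (mids (tabulate λ j → b i j , tabulate (c i j)))) _)))
  map-F : map F (allLinks (suc r) s k) ≡ W
  map-F = trans (map-++ F (concat (tabulate (lobeLinks (suc r) s k))) _) (cong₂ _++_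
    (trans (sym (concat-map (tabulate (lobeLinks (suc r) s k)))) (cong concat
      (trans (map-tabulate (lobeLinks (suc r) s k) (map F)) (trans (tabulate-cong lobe-links)
        (sym (map-tabulate (λ i → a i , tabulate λ j → b i j , tabulate (c i j)) lobeEdges))))))
    (trans (map-tabulate (λ i → spinal (inject₁ i) , spinal (suc i)) F) (sym (trans (cong links spine≡) (links-tabulate a)))))
  -- The fictitious edge accounts for the excess of vertices over links.
  N≡ : N ≡ suc (length (allLinks (suc r) s k))
  N≡ = trans (sym (length-iv 1 N)) (trans (sym (↭-length (proj₂ W↭)))
    (cong suc (trans (cong length (sym map-F)) (length-map F (allLinks (suc r) s k)))))

-- Transfer from positions to the vertices of the graph.

unique-⊆⇒length≤ : ∀ {A : Set} {xs ys : List A} → Unique xs → (∀ {x} → x ∈ xs → x ∈ ys) → length xs ≤ length ys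
unique-⊆⇒length≤ []        xs⊆ys = z≤n
unique-⊆⇒length≤ {xs = x ∷ xs} (x≢ ∷ u) xs⊆ys with ∈-∃++ (xs⊆ys (here refl))
... | as , bs , refl = ≤-trans (s≤s (unique-⊆⇒length≤ u xs⊆rest)) (≤-reflexive (sym (↭-length (shift x as bs))))
  where
  xs⊆rest : ∀ {y} → y ∈ xs → y ∈ as ++ bs
  xs⊆rest y∈ with ∈-resp-↭ (shift x as bs) (xs⊆ys (there y∈))
  ... | here refl = contradiction refl (All.lookup x≢ y∈)
  ... | there y∈′ = y∈′

unique-≡-length : ∀ {A : Set} {xs ys : List A} → Unique xs → Unique ys → (∀ {x} → x ∈ xs ⇔ x ∈ ys) → length xs ≡ length ys
unique-≡-length ux uy xs⇔ys = ≤-antisym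
  (unique-⊆⇒length≤ ux (Equivalence.to xs⇔ys))
  (unique-⊆⇒length≤ uy (Equivalence.from xs⇔ys))

module Labels {n : ℕ} (G : Graph (Fin n)) (L : Lobster G) where
  open Lobster L
  open Inverse position using (to; from; strictlyInverseˡ; strictlyInverseʳ)

  to-injective : ∀ {x y} → to x ≡ to y → x ≡ y
  to-injective {x} {y} eq = trans (sym (strictlyInverseʳ x)) (trans (cong from eq) (strictlyInverseʳ y))

  from-injective : ∀ {p q} → from p ≡ from q → p ≡ q
  from-injective {p} {q} eq = trans (sym (strictlyInverseˡ p)) (trans (cong to eq) (strictlyInverseˡ q))

  link⇒adj : ∀ {p q} → Link r s k p q → Adj G (from p) (from q)
  link⇒adj {p} {q} l = Equivalence.from (adjacent (from p) (from q))
    (inj₁ (subst₂ (Link r s k) (sym (strictlyInverseˡ p)) (sym (strictlyInverseˡ q)) l))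

  edges-complete : ∀ {x y} → Adj G x y → (x , y) ∈ edges G ⊎ (y , x) ∈ edges G
  edges-complete {x} {y} x~y with Fin.<-cmp x y
  ... | tri< x<y _ _ = inj₁ (∈-filter⁺ _ (∈-cartesianProduct⁺ (∈-allFin x) (∈-allFin y)) (x<y , x~y))
  ... | tri≈ _ refl _ = contradiction x~y (Graph.irrefl G refl)
  ... | tri> _ _ y<x = inj₂ (∈-filter⁺ _ (∈-cartesianProduct⁺ (∈-allFin y) (∈-allFin x)) (y<x , Graph.sym G x~y))

  graceful : PositionLabelling r s k → Graceful G
  graceful lab = f , f-injective , edge-labels-distinct
    where
    open PositionLabelling lab
    m = length (allLinks r s k)
    F : Position r s k × Position r s k → ℕ
    F (p , q) = ∣ label p - label q ∣
    F′ : Fin n × Fin n → ℕ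
    F′ (x , y) = ∣ label (to x) - label (to y) ∣
    covered : ∀ {w} → w ∈ map F (allLinks r s k) → w ∈ map F′ (edges G)
    F′≡F : ∀ p q → F′ (from p , from q) ≡ F (p , q)
    F′≡F p q = cong₂ (λ p q → ∣ label p - label q ∣) (strictlyInverseˡ p) (strictlyInverseˡ q)
    covered w∈ with ∈-map⁻ F w∈
    ... | (p , q) , pq∈ , refl with edges-complete (link⇒adj (allLinks-sound r s k pq∈))
    ...   | inj₁ e∈ = subst (_∈ map F′ (edges G)) (F′≡F p q) (∈-map⁺ F′ e∈)
    ...   | inj₂ e∈ = subst (_∈ map F′ (edges G)) (trans (∣-∣-comm _ (label (to (from p)))) (F′≡F p q))
                     (∈-map⁺ F′ e∈)
    -- Each of the `m` distinct link labels occurs on a listed edge of the graph, so labels up to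
    -- `m` fit into the required range.
    m≤ : m ≤ edgeCount G
    m≤ = subst₂ _≤_ (length-map F (allLinks r s k)) (length-map F′ (edges G)) (unique-⊆⇒length≤ unique-labels covered)
    label< : ∀ x → label (to x) < suc (edgeCount G)
    label< x = s≤s (≤-trans (bounded (to x)) m≤)
    f : Fin n → Fin (suc (edgeCount G))
    f x = fromℕ< (label< x)
    toℕ-f : ∀ x → toℕ (f x) ≡ label (to x)
    toℕ-f x = toℕ-fromℕ< (label< x)
    f-injective : ∀ {x y} → f x ≡ f y → x ≡ y
    f-injective {x} {y} eq = to-injective (injective _ _ (trans (sym (toℕ-f x)) (trans (cong toℕ eq) (toℕ-f y))))
    same-link : ∀ {p q p′ q′} → Link r s k p q → Link r s k p′ q′ → F (p , q) ≡ F (p′ , q′) → (p , q) ≡ (p′ , q′)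
    same-link l l′ = unique-map-injective unique-labels (allLinks-complete r s k l) (allLinks-complete r s k l′)
    edge-labels-distinct : ∀ u v x y → Adj G u v → Adj G x y → ∣ toℕ (f u) - toℕ (f v) ∣ ≡ ∣ toℕ (f x) - toℕ (f y) ∣ →
         (u ≡ x × v ≡ y) ⊎ (u ≡ y × v ≡ x)
    edge-labels-distinct u v x y uv xy eq
      rewrite toℕ-f u | toℕ-f v | toℕ-f x | toℕ-f y
      -- Either edge may run with or against its link; equal labels force equal links, and opposite
      -- orientations give the crossed alternative.
      with Equivalence.to (adjacent u v) uv | Equivalence.to (adjacent x y) xy
    ... | inj₁ l | inj₁ l′ = let e = same-link l l′ eq in inj₁ (to-injective (cong proj₁ e) , to-injective (cong proj₂ e))
    ... | inj₁ l | inj₂ l′ = let e = same-link l l′ (trans eq (∣-∣-comm (label (to x)) _)) in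
                             inj₂ (to-injective (cong proj₁ e) , to-injective (cong proj₂ e))
    ... | inj₂ l | inj₁ l′ = let e = same-link l l′ (trans (∣-∣-comm (label (to v)) _) eq) in
                             inj₂ (to-injective (cong proj₂ e) , to-injective (cong proj₁ e))
    ... | inj₂ l | inj₂ l′ = let e = same-link l l′ (trans (∣-∣-comm (label (to v)) _) (trans eq (∣-∣-comm (label (to x)) _))) in
                             inj₁ (to-injective (cong proj₂ e) , to-injective (cong proj₁ e))

-- Subsets as lists, and degrees under isomorphism.

toList : ∀ {n} → Subset n → List (Fin n)
toList []          = []
toList (true  ∷ S) = zero ∷ map suc (toList S)
toList (false ∷ S) = map suc (toList S)

length-toList : ∀ {n} (S : Subset n) → length (toList S) ≡ ∣ S ∣
length-toList []          = refl
length-toList (true  ∷ S) = cong suc (trans (length-map suc (toList S)) (length-toList S))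
length-toList (false ∷ S) = trans (length-map suc (toList S)) (length-toList S)

∈-toList⁺ : ∀ {n x} {S : Subset n} → x ∈ˢ S → x ∈ toList S
∈-toList⁺ {S = true  ∷ S} here       = here refl
∈-toList⁺ {S = true  ∷ S} (there x∈) = there (∈-map⁺ suc (∈-toList⁺ x∈))
∈-toList⁺ {S = false ∷ S} (there x∈) = ∈-map⁺ suc (∈-toList⁺ x∈)

∈-toList⁻ : ∀ {n x} (S : Subset n) → x ∈ toList S → x ∈ˢ S
∈-toList⁻ (true ∷ S)  (here refl) = here
∈-toList⁻ (true ∷ S)  (there x∈) with ∈-map⁻ suc x∈
... | y , y∈ , refl = there (∈-toList⁻ S y∈)
∈-toList⁻ (false ∷ S) x∈ with ∈-map⁻ suc x∈
... | y , y∈ , refl = there (∈-toList⁻ S y∈)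

toList-unique : ∀ {n} (S : Subset n) → Unique (toList S)
toList-unique []          = []
toList-unique (true ∷ S)  = All.map⁺ (All.universal (λ _ ()) (toList S)) ∷ Unique.map⁺ Fin.suc-injective (toList-unique S)
toList-unique (false ∷ S) = Unique.map⁺ Fin.suc-injective (toList-unique S)

∣∣≡length : ∀ {n} (S : Subset n) {xs} → Unique xs → (∀ {x} → x ∈ˢ S ⇔ x ∈ xs) → ∣ S ∣ ≡ length xs
∣∣≡length S u S⇔xs = trans (sym (length-toList S)) (unique-≡-length (toList-unique S) u
  (mk⇔ (Equivalence.to S⇔xs ∘ ∈-toList⁻ S) (∈-toList⁺ ∘ Equivalence.from S⇔xs)))

∈-tabulateˢ : ∀ {n} {f : Fin n → Bool} {x} → x ∈ˢ Vec.tabulate f ⇔ f x ≡ true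
∈-tabulateˢ {f = f} {x} = mk⇔ (λ x∈ → trans (sym (Vec.lookup∘tabulate f x)) (Vec.[]=⇒lookup x∈))
                              (λ eq → Vec.lookup⇒[]= x _ (trans (Vec.lookup∘tabulate f x) eq))

x∈p─q⁺ : ∀ {n x} {p q : Subset n} → x ∈ˢ p → x ∉ˢ q → x ∈ˢ p ─ q
x∈p─q⁺ {q = true  ∷ q} here       x∉q = contradiction here x∉q
x∈p─q⁺ {q = false ∷ q} here       x∉q = here
x∈p─q⁺ {q = _ ∷ q}     (there x∈) x∉q = there (x∈p─q⁺ x∈ (x∉q ∘ there))

x∈p─q⁻ : ∀ {n x} (p q : Subset n) → x ∈ˢ p ─ q → x ∈ˢ p × x ∉ˢ q
x∈p─q⁻ {x = zero}  (true ∷ p)  (false ∷ q) here = here , λ ()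
x∈p─q⁻ {x = zero}  (false ∷ p) (true ∷ q)  ()
x∈p─q⁻ {x = zero}  (false ∷ p) (false ∷ q) ()
x∈p─q⁻ (_ ∷ p) (_ ∷ q) (there x∈) with x∈p─q⁻ p q x∈
... | x∈p , x∉q = there x∈p , λ { (there x∈q) → x∉q x∈q }

does-true⁻ : ∀ {P : Set} (d : Dec P) → does d ≡ true → P
does-true⁻ (yes p) _ = p

-- An induced subgraph has a `Σ`-type of vertices, where subsets of `Fin n` do not apply directly; a
-- duplicate-free list of neighbours certifies the degree instead.
record Neighbourhood {V : Set} (H : Graph V) (x : V) (d : ℕ) : Set where
  field
    nbrs     : List V
    unique   : Unique nbrs
    sound    : ∀ {y} → y ∈ nbrs → Adj H x y
    complete : ∀ {y} → Adj H x y → y ∈ nbrs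
    degree   : length nbrs ≡ d

≅-degree : ∀ {V W : Set} {H : Graph V} {K : Graph W} (iso : H ≅ K) {x d d′} →
  Neighbourhood H x d → Neighbourhood K (Inverse.to (proj₁ iso) x) d′ → d ≡ d′
≅-degree {H = H} {K} (φ , adj) {x} N N′ = trans (sym N.degree) (trans (sym (length-map to N.nbrs))
    (trans (unique-≡-length (Unique.map⁺ injective N.unique) N′.unique (mk⇔ forth back)) N′.degree))
  where
  module N = Neighbourhood N
  module N′ = Neighbourhood N′
  open Inverse φ using (to; from; strictlyInverseˡ; strictlyInverseʳ)
  injective : ∀ {x y} → to x ≡ to y → x ≡ y
  injective {x} {y} eq = trans (sym (strictlyInverseʳ x)) (trans (cong from eq) (strictlyInverseʳ y))
  forth : ∀ {y} → y ∈ map to N.nbrs → y ∈ N′.nbrs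
  forth y∈ with ∈-map⁻ to y∈
  ... | z , z∈ , refl = N′.complete (Equivalence.to (adj x z) (N.sound z∈))
  back : ∀ {y} → y ∈ N′.nbrs → y ∈ map to N.nbrs
  back {y} y∈ = subst (_∈ map to N.nbrs) (strictlyInverseˡ y) (∈-map⁺ to (N.complete
    (Equivalence.from (adj x (from y)) (subst (Adj K (to x)) (sym (strictlyInverseˡ y)) (N′.sound y∈)))))

-- The image of one enumeration of the vertices and the other enumeration are duplicate-free with
-- the same elements, hence permutations of each other.
≅-degrees : ∀ {V W : Set} {H : Graph V} {K : Graph W} → H ≅ K →
  (deg : V → ℕ) (deg′ : W → ℕ) → (∀ x → Neighbourhood H x (deg x)) → (∀ y → Neighbourhood K y (deg′ y)) →
  ∀ {xs ys} → Unique xs → (∀ x → x ∈ xs) → Unique ys → (∀ y → y ∈ ys) → map deg xs ↭ map deg′ ys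
≅-degrees iso@(φ , _) deg deg′ N N′ {xs} {ys} ux cx uy cy = ↭-trans
  (↭-reflexive (trans (map-cong (λ x → ≅-degree iso (N x) (N′ (to x))) xs) (map-∘ xs)))
  (map⁺ deg′ (∼bag⇒↭ (unique∧set⇒bag (Unique.map⁺ injective ux) uy
    (mk⇔ (λ _ → cy _) (λ _ → onto _)))))
  where
  open Inverse φ using (to; from; strictlyInverseˡ; strictlyInverseʳ)
  injective : ∀ {x y} → to x ≡ to y → x ≡ y
  injective {x} {y} eq = trans (sym (strictlyInverseʳ x)) (trans (cong from eq) (strictlyInverseʳ y))
  onto : ∀ y → y ∈ map to xs
  onto y = subst (_∈ map to xs) (strictlyInverseˡ y) (∈-map⁺ to (cx (from y)))

-- Recovering branch sizes from degrees.

big : List ℕ → List ℕ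
big = filter (2 ≤?_)

-- The centre is not told apart from the middle vertices by its degree; but the degrees ≥ 2 are those
-- of the middle vertices, together with that of the centre unless it is 1, so their number decides.
core-from-degrees : ∀ {ks ks′ X X′} → big X ≡ map suc ks → big X′ ≡ map suc ks′ →
  length ks ∷ X ↭ length ks′ ∷ X′ → ks ↭ ks′
core-from-degrees {ks} {ks′} {X} {X′} eq eq′ p = cases (2 ≤? length ks) (2 ≤? length ks′)
  where
  filtered : big (length ks ∷ X) ↭ big (length ks′ ∷ X′)
  filtered = filter-↭ (2 ≤?_) p
  map-suc⁻ : ∀ {xs ys} → map suc xs ↭ map suc ys → xs ↭ ys
  map-suc⁻ {xs} {ys} q = subst₂ _↭_ (trans (sym (map-∘ xs)) (map-id xs)) (trans (sym (map-∘ ys)) (map-id ys)) (map⁺ pred q)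
  accept : ∀ {ks X} → big X ≡ map suc ks → 2 ≤ length ks → big (length ks ∷ X) ≡ length ks ∷ map suc ks
  accept eq 2≤ = trans (filter-accept (2 ≤?_) 2≤) (cong (_ ∷_) eq)
  reject : ∀ {ks X} → big X ≡ map suc ks → ¬ 2 ≤ length ks → big (length ks ∷ X) ≡ map suc ks
  reject eq 2≰ = trans (filter-reject (2 ≤?_) 2≰) eq
  absurd : ∀ {ks ks′ X X′} → big X ≡ map suc ks → big X′ ≡ map suc ks′ → big (length ks ∷ X) ↭ big (length ks′ ∷ X′) →
           2 ≤ length ks → 2 ≤ length ks′
  absurd {ks} {ks′} eq eq′ q 2≤ with 2 ≤? length ks′
  ... | yes 2≤′ = 2≤′
  -- Comparing lengths gives `suc (length ks) ≡ length ks′`, so `ks′` has at least two entries after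
  -- all.
  ... | no  2≰′ = subst (2 ≤_) (trans (cong suc (sym (length-map suc ks)))
          (trans (↭-length (subst₂ _↭_ (accept eq 2≤) (reject eq′ 2≰′) q)) (length-map suc ks′))) (m≤n⇒m≤1+n 2≤)
  cases : _ → _ → ks ↭ ks′
  -- Both centres survive the filter; equal lengths make their degrees equal, so they cancel.
  cases (yes a) (yes b) = map-suc⁻ (drop-∷ (subst (λ t → length ks ∷ map suc ks ↭ t ∷ map suc ks′) (sym t≡) q))
    where
    q = subst₂ _↭_ (accept eq a) (accept eq′ b) filtered
    t≡ : length ks ≡ length ks′
    t≡ = suc-injective (trans (cong suc (sym (length-map suc ks))) (trans (↭-length q) (cong suc (length-map suc ks′))))
  cases (no a)  (no b)  = map-suc⁻ (subst₂ _↭_ (reject eq a) (reject eq′ b) filtered)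
  cases (yes a) (no b)  = contradiction (absurd eq eq′ filtered a) b
  cases (no a)  (yes b) = contradiction (absurd eq′ eq (↭-sym filtered) b) a

core-map : ∀ {A : Set} (f : A → ℕ) xs → core (map f xs) ≡ map f (filter (λ x → ¬? (f x ≟ 0)) xs)
core-map f []       = refl
core-map f (x ∷ xs) with f x in eq
... | zero  = core-map f xs
... | suc m = cong₂ _∷_ (sym eq) (core-map f xs)

≡ᵇ0-false : ∀ {k} → (k ≡ᵇ 0) ≡ false → k ≢ 0
≡ᵇ0-false {suc k} _ ()

≢0⇒≡ᵇ0-false : ∀ {k} → k ≢ 0 → (k ≡ᵇ 0) ≡ false
≢0⇒≡ᵇ0-false {zero}  0≢0 = contradiction refl 0≢0
≢0⇒≡ᵇ0-false {suc k} _   = refl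

occupied : ∀ {k} → Fin k → k ≢ 0
occupied () refl

-- Reduced lobes as induced subgraphs.

module ReducedLobes {n : ℕ} (G : Graph (Fin n)) (L : Lobster G) where
  open Lobster L
  open Inverse position using (to; from; strictlyInverseˡ; strictlyInverseʳ)
  open Labels G L using (to-injective; from-injective)

  InReduced : Fin r → Pos r s k → Set
  InReduced i p = lobeOf p ≡ i × isPendant p ≡ false

  ∈-reducedLobe⁺ : ∀ {i x} → InReduced i (to x) → x ∈ˢ reducedLobe i
  ∈-reducedLobe⁺ {i} {x} (lobe≡ , nonpendant) = x∈p─q⁺
    (Equivalence.from ∈-tabulateˢ (dec-true (lobeOf (to x) Fin.≟ i) lobe≡))
    (λ x∈ → false≢true (trans (sym nonpendant) (Equivalence.to ∈-tabulateˢ x∈)))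
    where
    false≢true : false ≡ true → ⊥
    false≢true ()

  ∈-reducedLobe⁻ : ∀ {i x} → x ∈ˢ reducedLobe i → InReduced i (to x)
  ∈-reducedLobe⁻ {i} {x} x∈ with x∈p─q⁻ (lobe i) pendants x∈
  ... | x∈lobe , x∉pendants = does-true⁻ (lobeOf (to x) Fin.≟ i) (Equivalence.to ∈-tabulateˢ x∈lobe) , nonpendant _ refl
    where
    nonpendant : ∀ b → isPendant (to x) ≡ b → isPendant (to x) ≡ false
    nonpendant true  eq = contradiction (Equivalence.from ∈-tabulateˢ eq) x∉pendants
    nonpendant false eq = eq

  branching : (i : Fin r) → List (Fin (s i))
  branching i = filter (λ j → ¬? (k i j ≟ 0)) (allFin (s i))

  branching-unique : ∀ i → Unique (branching i)
  branching-unique i = Unique.filter⁺ (λ j → ¬? (k i j ≟ 0)) (Unique.allFin⁺ (s i))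

  ∈-branching⁺ : ∀ {i j} → k i j ≢ 0 → j ∈ branching i
  ∈-branching⁺ {i} {j} k≢0 = ∈-filter⁺ (λ j → ¬? (k i j ≟ 0)) (∈-allFin j) k≢0

  ∈-branching⁻ : ∀ {i j} → j ∈ branching i → k i j ≢ 0
  ∈-branching⁻ {i} j∈ = proj₂ (∈-filter⁻ (λ j → ¬? (k i j ≟ 0)) {xs = allFin (s i)} j∈)

  core≡ : ∀ i → core (tabulate (k i)) ≡ map (k i) (branching i)
  core≡ i = trans (cong core (sym (map-tabulate id (k i)))) (core-map (k i) (allFin (s i)))

  nbrs : Pos r s k → List (Pos r s k)
  nbrs (spinal i)    = map (middle i) (branching i)
  nbrs (middle i j)  = spinal i ∷ tabulate (outer i j)
  nbrs (outer i j l) = middle i j ∷ []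

  degree : Pos r s k → ℕ
  degree (spinal i)    = length (branching i)
  degree (middle i j)  = suc (k i j)
  degree (outer i j l) = 1

  nbrs-length : ∀ p → length (nbrs p) ≡ degree p
  nbrs-length (spinal i)    = length-map {B = Pos r s k} (middle i) (branching i)
  nbrs-length (middle i j)  = cong suc (length-tabulate {A = Pos r s k} (outer i j))
  nbrs-length (outer i j l) = refl

  nbrs-unique : ∀ p → Unique (nbrs p)
  nbrs-unique (spinal i)    = Unique.map⁺ (λ { refl → refl }) (branching-unique i)
  nbrs-unique (middle i j)  = All.tabulate⁺ (λ _ ()) ∷ Unique.tabulate⁺ (λ { refl → refl })
  nbrs-unique (outer i j l) = [] ∷ []

  Linked : Pos r s k → Pos r s k → Set
  Linked p q = Link r s k p q ⊎ Link r s k q p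

  nbrs-sound : ∀ {i p q} → InReduced i p → q ∈ nbrs p → InReduced i q × Linked p q
  nbrs-sound {p = spinal i} (refl , _) q∈ with ∈-map⁻ (middle i) q∈
  ... | j , j∈ , refl = (refl , ≢0⇒≡ᵇ0-false (∈-branching⁻ j∈)) , inj₁ (toMiddle i j)
  nbrs-sound {p = middle i j} (refl , _) (here refl) = (refl , refl) , inj₂ (toMiddle i j)
  nbrs-sound {p = middle i j} (refl , _) (there q∈) with ∈-tabulate⁻ q∈
  ... | l , refl = (refl , refl) , inj₁ (toOuter i j l)
  nbrs-sound {p = outer i j l} (refl , _) (here refl) = (refl , ≢0⇒≡ᵇ0-false (occupied l)) , inj₂ (toOuter i j l)

  nbrs-complete : ∀ {i p q} → InReduced i p → InReduced i q → Linked p q → q ∈ nbrs p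
  -- A spine edge joins different lobes, so it cannot lie inside one.
  nbrs-complete (refl , _) (refl , _) (inj₁ (along i .i eq)) = contradiction (sym eq) 1+n≢n
  nbrs-complete (refl , _) (refl , _) (inj₂ (along i .i eq)) = contradiction (sym eq) 1+n≢n
  nbrs-complete (refl , _) (refl , q) (inj₁ (toMiddle i j))  = ∈-map⁺ (middle i) (∈-branching⁺ (≡ᵇ0-false q))
  nbrs-complete (refl , _) (refl , _) (inj₂ (toMiddle i j))  = here refl
  nbrs-complete (refl , _) (refl , _) (inj₁ (toOuter i j l)) = there (∈-tabulate⁺ l)
  nbrs-complete (refl , _) (refl , _) (inj₂ (toOuter i j l)) = here refl

  -- Turns essential oddness into a statement about the number of branches that are not pendant
  -- vertices.
  degree-spinal : ∀ i → degreeIn G (reducedLobe i) (v i) ≡ length (branching i)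
  degree-spinal i = trans (∣∣≡length (reducedLobe i ∩ neighbours G (v i))
      (Unique.map⁺ from-injective (nbrs-unique (spinal i))) (mk⇔ forth back))
      (trans (length-map from (nbrs (spinal i))) (nbrs-length (spinal i)))
    where
    forth : ∀ {x} → x ∈ˢ reducedLobe i ∩ neighbours G (v i) → x ∈ map from (nbrs (spinal i))
    forth {x} x∈ with x∈p∩q⁻ (reducedLobe i) (neighbours G (v i)) x∈
    ... | x∈S , x∈N = subst (_∈ map from (nbrs (spinal i))) (strictlyInverseʳ x) (∈-map⁺ from
            (nbrs-complete {i} {spinal i} (refl , refl) (∈-reducedLobe⁻ x∈S)
              (subst (λ p → Linked p (to x)) (strictlyInverseˡ (spinal i))
                (Equivalence.to (adjacent (v i) x) (does-true⁻ (adj? G (v i) x) (Equivalence.to ∈-tabulateˢ x∈N))))))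
    back : ∀ {x} → x ∈ map from (nbrs (spinal i)) → x ∈ˢ reducedLobe i ∩ neighbours G (v i)
    back x∈ with ∈-map⁻ from x∈
    ... | p , p∈ , refl with nbrs-sound {i} {spinal i} (refl , refl) p∈
    ...   | inR , linked = x∈p∩q⁺ (∈-reducedLobe⁺ (subst (InReduced i) (sym (strictlyInverseˡ p)) inR)
            , Equivalence.from ∈-tabulateˢ (dec-true (adj? G (v i) (from p)) (Equivalence.from (adjacent (v i) (from p))
                (subst₂ Linked (sym (strictlyInverseˡ (spinal i))) (sym (strictlyInverseˡ p)) linked))))

  Vertex : Fin r → Set
  Vertex i = Σ[ x ∈ Fin n ] x ∈ˢ reducedLobe i

  pos : ∀ {i} → Vertex i → Pos r s k
  pos = to ∘ proj₁

  pos-injective : ∀ {i} {x y : Vertex i} → pos x ≡ pos y → x ≡ y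
  pos-injective {i} {x , x∈} {y , y∈} eq with to-injective eq
  ... | refl = cong (x ,_) ([]=-irrelevant x∈ y∈)

  -- Lists of vertices of the induced subgraph are obtained from lists of positions; uniqueness and
  -- completeness then carry over along the equation for `map pos`.
  lift : ∀ {i} ps → All (InReduced i) ps → ∃ λ (xs : List (Vertex i)) → map pos xs ≡ ps
  lift []       []         = [] , refl
  lift {i} (p ∷ ps) (inR ∷ inRs) with lift ps inRs
  ... | xs , refl = (from p , ∈-reducedLobe⁺ (subst (InReduced i) (sym (strictlyInverseˡ p)) inR)) ∷ xs
                  , cong (_∷ map pos xs) (strictlyInverseˡ p)

  ∈-map-pos⁻ : ∀ {i} {x : Vertex i} {xs} → pos x ∈ map pos xs → x ∈ xs
  ∈-map-pos⁻ {xs = xs} px∈ with ∈-map⁻ pos px∈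
  ... | y , y∈ , eq = subst (_∈ xs) (sym (pos-injective eq)) y∈

  neighbourhood : ∀ {i} (x : Vertex i) → Neighbourhood (induced G (reducedLobe i)) x (degree (pos x))
  neighbourhood {i} x with lift (nbrs (pos x)) (All.tabulate (proj₁ ∘ nbrs-sound {i} {pos x} (∈-reducedLobe⁻ (proj₂ x))))
  ... | xs , eq = record
    { nbrs     = xs
    ; unique   = Unique.map⁻ (subst Unique (sym eq) (nbrs-unique (pos x)))
    ; sound    = λ {y} y∈ → Equivalence.from (adjacent (proj₁ x) (proj₁ y))
                   (proj₂ (nbrs-sound {i} {pos x} inR (subst (pos y ∈_) eq (∈-map⁺ pos y∈))))
    ; complete = λ {y} x~y → ∈-map-pos⁻ (subst (pos y ∈_) (sym eq) (nbrs-complete inR (∈-reducedLobe⁻ (proj₂ y))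
                   (Equivalence.to (adjacent (proj₁ x) (proj₁ y)) x~y)))
    ; degree   = trans (sym (length-map pos xs)) (trans (cong length eq) (nbrs-length (pos x)))
    }
    where inR = ∈-reducedLobe⁻ {i} (proj₂ x)

  branch : (i : Fin r) → Fin (s i) → List (Pos r s k)
  branch i j = middle i j ∷ tabulate (outer i j)

  branches : (i : Fin r) → List (Fin (s i)) → List (Pos r s k)
  branches i = concatMap (branch i)

  ∈-branches⁻ : ∀ {i p} js → p ∈ branches i js → ∃ λ j → j ∈ js × p ∈ branch i j
  ∈-branches⁻ {i} js p∈ with ∈-concat⁻′ (map (branch i) js) p∈
  ... | _ , p∈b , b∈ with ∈-map⁻ (branch i) b∈
  ...   | j , j∈ , refl = j , j∈ , p∈b

  ∈-branches⁺ : ∀ {i p j js} → j ∈ js → p ∈ branch i j → p ∈ branches i js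
  ∈-branches⁺ {i} j∈ p∈ = ∈-concat⁺′ p∈ (∈-map⁺ (branch i) j∈)

  branches-disjoint : ∀ {i j j′ p} → p ∈ branch i j → p ∈ branch i j′ → j ≡ j′
  branches-disjoint (here refl) (here refl) = refl
  branches-disjoint (here refl) (there p∈) with ∈-tabulate⁻ p∈
  ... | _ , ()
  branches-disjoint (there p∈) p∈′ with ∈-tabulate⁻ p∈
  branches-disjoint (there p∈) (there p∈′) | l , refl with ∈-tabulate⁻ p∈′
  ... | _ , refl = refl

  branches-unique : ∀ i {js} → Unique js → Unique (branches i js)
  branches-unique i []               = []
  branches-unique i {j ∷ js} (j≢ ∷ u) = Unique.++⁺ (All.tabulate⁺ (λ _ ()) ∷ Unique.tabulate⁺ (λ { refl → refl }))
    (branches-unique i u) λ { (p∈ , p∈′) → let j′ , j′∈ , p∈″ = ∈-branches⁻ js p∈′ in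
      All.lookup j≢ j′∈ (branches-disjoint p∈ p∈″) }

  reducedPositions : Fin r → List (Pos r s k)
  reducedPositions i = spinal i ∷ branches i (branching i)

  reducedPositions-unique : ∀ i → Unique (reducedPositions i)
  reducedPositions-unique i =
    All.tabulate (λ p∈ eq → ∉spinal (subst (_∈ branches i (branching i)) (sym eq) p∈)) ∷
    branches-unique i (branching-unique i)
    where
    ∉spinal : ¬ spinal i ∈ branches i (branching i)
    ∉spinal p∈ with ∈-branches⁻ (branching i) p∈
    ... | j , _ , there p∈′ with ∈-tabulate⁻ p∈′
    ...   | _ , ()

  reducedPositions-sound : ∀ i → All (InReduced i) (reducedPositions i)
  reducedPositions-sound i = (refl , refl) ∷ All.tabulate inR
    where
    inR : ∀ {p} → p ∈ branches i (branching i) → InReduced i p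
    inR p∈ with ∈-branches⁻ (branching i) p∈
    ... | j , j∈ , here refl = refl , ≢0⇒≡ᵇ0-false (∈-branching⁻ j∈)
    ... | j , j∈ , there p∈′ with ∈-tabulate⁻ p∈′
    ...   | l , refl = refl , refl

  reducedPositions-complete : ∀ {i} p → InReduced i p → p ∈ reducedPositions i
  reducedPositions-complete (spinal i)    (refl , _) = here refl
  reducedPositions-complete (middle i j)  (refl , q) = there (∈-branches⁺ (∈-branching⁺ (≡ᵇ0-false q)) (here refl))
  reducedPositions-complete (outer i j l) (refl , _) = there (∈-branches⁺ (∈-branching⁺ (occupied l)) (there (∈-tabulate⁺ l)))

  -- In a reduced lobe the outer vertices have degree 1, whereas a middle vertex has its outer
  -- vertices and the centre as neighbours, hence degree at least 2.
  big-degrees : ∀ i {js} → All (λ j → k i j ≢ 0) js → big (map degree (branches i js)) ≡ map suc (map (k i) js)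
  big-degrees i []                     = refl
  big-degrees i {j ∷ js} (k≢0 ∷ k≢0s) = trans (cong big (map-++ degree (branch i j) (branches i js)))
    (trans (filter-++ (2 ≤?_) (map degree (branch i j)) (map degree (branches i js)))
    (cong₂ _++_ (trans (filter-accept (2 ≤?_) (s≤s (n≢0⇒n>0 k≢0)))
                  (cong (suc (k i j) ∷_) (trans (cong big (map-tabulate (outer i j) degree))
                    (filter-none (2 ≤?_) (All.tabulate⁺ {f = λ (_ : Fin (k i j)) → 1} (λ _ → λ { (s≤s ()) }))))))
                (big-degrees i k≢0s)))

  -- Both reduced lobes are enumerated with the centre first, which gives the degree lists the form
  -- required by `core-from-degrees`.
  similar⇒core-↭ : ∀ {i i′} → induced G (reducedLobe i) ≅ induced G (reducedLobe i′) →
    core (tabulate (k i)) ↭ core (tabulate (k i′))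
  similar⇒core-↭ {i} {i′} iso
    with lift (reducedPositions i) (reducedPositions-sound i) | lift (reducedPositions i′) (reducedPositions-sound i′)
  ... | xs , eq | xs′ , eq′ = subst₂ _↭_ (sym (core≡ i)) (sym (core≡ i′)) (core-from-degrees
        (big-degrees i (All.tabulate ∈-branching⁻)) (big-degrees i′ (All.tabulate ∈-branching⁻))
        (subst₂ _↭_ (degrees eq) (degrees eq′)
          (≅-degrees iso (degree ∘ pos) (degree ∘ pos) neighbourhood neighbourhood
            (enum-unique eq) (enum-complete eq) (enum-unique eq′) (enum-complete eq′))))
    where
    degrees : ∀ {i} {xs : List (Vertex i)} → map pos xs ≡ reducedPositions i →
      map (degree ∘ pos) xs ≡ length (map (k i) (branching i)) ∷ map degree (branches i (branching i))
    degrees {i} {xs} eq = trans (map-∘ xs) (trans (cong (map degree) eq)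
      (cong (_∷ map degree (branches i (branching i))) (sym (length-map (k i) (branching i)))))
    enum-unique : ∀ {i} {xs : List (Vertex i)} → map pos xs ≡ reducedPositions i → Unique xs
    enum-unique {i} eq = Unique.map⁻ (subst Unique (sym eq) (reducedPositions-unique i))
    enum-complete : ∀ {i} {xs : List (Vertex i)} → map pos xs ≡ reducedPositions i → ∀ x → x ∈ xs
    enum-complete eq x = ∈-map-pos⁻ (subst (pos x ∈_) (sym eq) (reducedPositions-complete (pos x) (∈-reducedLobe⁻ (proj₂ x))))

-- Pairing the lobes, and the conclusion.

good-tabulate : ∀ {r} (f : Fin r → List ℕ) → (∀ i → Odd (length (core (f i)))) →
  (∀ i i′ → Odd (suc (toℕ i)) → toℕ i′ ≡ suc (toℕ i) → core (f i) ↭ core (f i′)) → Good (tabulate f)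
good-tabulate {zero}        f odd sim = []
good-tabulate {suc zero}    f odd sim = one (odd zero)
good-tabulate {suc (suc r)} f odd sim = pair (odd zero) (↭-sym (sim zero (suc zero) refl refl))
  (good-tabulate (λ i → f (suc (suc i))) (λ i → odd (suc (suc i)))
    -- Removing two lobes shifts all indices by two, which preserves parity.
    (λ i i′ o eq → sim (suc (suc i)) (suc (suc i′)) (trans (unshift (suc (toℕ i))) o) (cong (λ n → suc (suc n)) eq)))
  where
  unshift : ∀ n → suc (suc n) % 2 ≡ n % 2
  unshift n = trans (cong (_% 2) (+-comm 2 n)) ([m+n]%n≡m%n n 2)

theorem4p2 : (n : ℕ) (G : Graph (Fin n)) (L : Lobster G) →
    Lobster.PairwiseSimilar L →
    (∀ i → Lobster.EssentiallyOdd L i) →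
    Graceful G
theorem4p2 n G L similar odd = graceful (positionLabelling r s k r≥1 (good-tabulate (λ i → tabulate (k i))
    (λ i → subst Odd (trans (degree-spinal i) (sym (trans (cong length (core≡ i)) (length-map (k i) (branching i))))) (odd i))
    (λ i i′ o eq → similar⇒core-↭ (similar i i′ o eq))))
  where
  open Lobster L
  open Labels G L
  open ReducedLobes G L
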